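{- Let $G$ be a graph on $[n]$ such that every $3$-subset of $[n]$ contains an edge of $G$. Then $E(G)$ dominates $B(n)$, where $B(n)=\{\{a,b\}: 1\le a<b\le n,\ a+b\le n\}$.
   Context: Let $X=(x_{ij})_{1\le i,j\le n}$ be a matrix of $n^2$ independent indeterminates over $\mathbb{Q}$, and for $1\le k\le n$ let $C_k(X)=(c_{S,T})$ be its $k$-th compound matrix: rows and columns are indexed by $k$-subsets $S,T$ of $[n]$, and $c_{S,T}=\det(x_{ij})_{i\in S,j\in T}$, computed in the field $\mathbb{Q}(x_{ij})$. For two families $F_1,F_2$ of $k$-subsets of $[n]$, $F_1$ dominates $F_2$ if the submatrix of $C_k(X)$ with rows indexed by $F_2$ and columns indexed by $F_1$ has rank $|F_2|$. A graph is identified with its set of edges, a family of $2$-subsets. -}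

module Defs where

open import Level using (0ℓ; _⊔_)
open import Algebra.Bundles using (CommutativeRing; AbelianGroup)
open import Algebra.Apartness.Bundles using (HeytingField; HeytingCommutativeRing)
open import Data.Empty using (⊥-elim)
open import Data.Fin.Base as Fin using (Fin; zero; suc)
open import Data.Fin.Subset using (Subset; inside; outside; ∣_∣)
open import Data.List.Base as List using (List; []; _∷_; _++_)
open import Data.List.Membership.Propositional using (_∈_)
open import Data.List.Membership.Propositional.Properties using (∈-map⁺; ∈-map⁻; ∈-++⁺ˡ; ∈-++⁺ʳ)
open import Data.List.Relation.Unary.All using ([])
open import Data.List.Relation.Unary.Any using (here)
open import Data.List.Relation.Unary.Unique.Propositional using (Unique; []; _∷_)
open import Data.List.Relation.Unary.Unique.Propositional.Properties using (map⁺; ++⁺)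
open import Data.Nat.Base as ℕ using (ℕ; zero; suc)
import Data.Nat.Properties as ℕ
open import Data.Product.Base using (∃; ∃-syntax; _×_; _,_)
open import Data.Rational.Base as ℚ using (ℚ)
import Data.Rational.Properties as ℚ
open import Data.Sum.Base as Sum using (_⊎_; inj₁; inj₂)
open import Data.Vec.Base as Vec using (Vec; []; _∷_)
open import Function.Base using (_∘_)
open import Relation.Binary.Bundles using (DecSetoid)
open import Relation.Binary.Definitions as Binary using ()
open import Relation.Binary.PropositionalEquality as ≡ using (_≡_)
open import Relation.Nullary using (Dec; yes; no; ¬_)
open import Relation.Nullary.Decidable using (map′; _×-dec_)
open import Relation.Unary using (Pred; Decidable)
import Algebra.Properties.Group
import Algebra.Properties.Ring
import Algebra.Properties.CommutativeSemigroup
import Algebra.Properties.Semiring.Exp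
import Algebra.Properties.Semiring.Sum
import Relation.Binary.Properties.DecSetoid
import Relation.Binary.Reasoning.Setoid
import Algebra.Solver.Ring.NaturalCoefficients.Default

record IntegralDomain : Set₁ where
  field
    commutativeRing : CommutativeRing 0ℓ 0ℓ

  open CommutativeRing commutativeRing public

  infix 4 _≟_
  field
    _≟_            : Binary.Decidable _≈_
    1≉0            : ¬ (1# ≈ 0#)
    noZeroDivisors : ∀ {x y} → x * y ≈ 0# → x ≈ 0# ⊎ y ≈ 0#

module Polynomials (D : IntegralDomain) where
  private
    module D = IntegralDomain D
    open Algebra.Properties.Ring D.ring using (-0#≈0#)

  -- a₀ ∷ a₁ ∷ … ∷ [] is a₀ + a₁t + …; trailing zeros are allowed, so
  -- polynomials are compared coefficientwise.
  Poly : Set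
  Poly = List D.Carrier

  coeff : Poly → ℕ → D.Carrier
  coeff []      _       = D.0#
  coeff (a ∷ p) zero    = a
  coeff (a ∷ p) (suc i) = coeff p i

  infix 4 _≈_
  record _≈_ (p q : Poly) : Set where
    constructor coeffwise
    field at : ∀ i → coeff p i D.≈ coeff q i
  open _≈_ public

  infixl 6 _+_
  infixl 7 _*_ _·_
  infix  8 -_

  _+_ : Poly → Poly → Poly
  []      + q       = q
  (a ∷ p) + []      = a ∷ p
  (a ∷ p) + (b ∷ q) = (a D.+ b) ∷ (p + q)

  -_ : Poly → Poly
  - p = List.map D.-_ p

  _·_ : D.Carrier → Poly → Poly
  a · p = List.map (a D.*_) p

  _*_ : Poly → Poly → Poly
  []      * q = []
  (a ∷ p) * q = a · q + (D.0# ∷ p * q)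

  const : D.Carrier → Poly
  const a = a ∷ []

  0# 1# t : Poly
  0# = []
  1# = const D.1#
  t  = D.0# ∷ D.1# ∷ []

  coeff-+ : ∀ p q i → coeff (p + q) i D.≈ coeff p i D.+ coeff q i
  coeff-+ []      q       i       = D.sym (D.+-identityˡ _)
  coeff-+ (a ∷ p) []      i       = D.sym (D.+-identityʳ _)
  coeff-+ (a ∷ p) (b ∷ q) zero    = D.refl
  coeff-+ (a ∷ p) (b ∷ q) (suc i) = coeff-+ p q i

  coeff-neg : ∀ p i → coeff (- p) i D.≈ D.- coeff p i
  coeff-neg []      i       = D.sym -0#≈0#
  coeff-neg (a ∷ p) zero    = D.refl
  coeff-neg (a ∷ p) (suc i) = coeff-neg p i

  coeff-· : ∀ a p i → coeff (a · p) i D.≈ a D.* coeff p i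
  coeff-· a []      i       = D.sym (D.zeroʳ a)
  coeff-· a (b ∷ p) zero    = D.refl
  coeff-· a (b ∷ p) (suc i) = coeff-· a p i

  refl : ∀ {p} → p ≈ p
  refl = coeffwise λ _ → D.refl

  sym : ∀ {p q} → p ≈ q → q ≈ p
  sym e = coeffwise λ i → D.sym (at e i)

  trans : ∀ {p q r} → p ≈ q → q ≈ r → p ≈ r
  trans e f = coeffwise λ i → D.trans (at e i) (at f i)

  ∷-cong : ∀ {a b p q} → a D.≈ b → p ≈ q → a ∷ p ≈ b ∷ q
  ∷-cong e f = coeffwise λ { zero → e ; (suc i) → at f i }

  tail-≈ : ∀ {a b p q} → a ∷ p ≈ b ∷ q → p ≈ q
  tail-≈ e = coeffwise λ i → at e (suc i)

  ∷≈[] : ∀ {a p} → a D.≈ D.0# → p ≈ [] → a ∷ p ≈ []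
  ∷≈[] e f = coeffwise λ { zero → e ; (suc i) → at f i }

  tail≈[] : ∀ {a p} → a ∷ p ≈ [] → p ≈ []
  tail≈[] e = coeffwise λ i → at e (suc i)

  +-cong : ∀ {p p′ q q′} → p ≈ p′ → q ≈ q′ → p + q ≈ p′ + q′
  +-cong {p} {p′} {q} {q′} e f = coeffwise λ i →
    D.trans (coeff-+ p q i)
      (D.trans (D.+-cong (at e i) (at f i)) (D.sym (coeff-+ p′ q′ i)))

  +-assoc : ∀ p q r → (p + q) + r ≈ p + (q + r)
  +-assoc p q r = coeffwise λ i →
    D.trans (coeff-+ (p + q) r i) (D.trans (D.+-congʳ (coeff-+ p q i))
      (D.trans (D.+-assoc _ _ _) (D.sym
        (D.trans (coeff-+ p (q + r) i) (D.+-congˡ (coeff-+ q r i))))))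

  +-comm : ∀ p q → p + q ≈ q + p
  +-comm p q = coeffwise λ i →
    D.trans (coeff-+ p q i) (D.trans (D.+-comm _ _) (D.sym (coeff-+ q p i)))

  +-identityʳ : ∀ p → p + [] ≈ p
  +-identityʳ p = +-comm p []

  -‿cong : ∀ {p q} → p ≈ q → - p ≈ - q
  -‿cong {p} {q} e = coeffwise λ i →
    D.trans (coeff-neg p i) (D.trans (D.-‿cong (at e i)) (D.sym (coeff-neg q i)))

  -‿inverseˡ : ∀ p → - p + p ≈ []
  -‿inverseˡ p = coeffwise λ i →
    D.trans (coeff-+ (- p) p i)
      (D.trans (D.+-congʳ (coeff-neg p i)) (D.-‿inverseˡ _))

  +-abelianGroup : AbelianGroup 0ℓ 0ℓ
  +-abelianGroup = record
    { Carrier = Poly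
    ; _≈_ = _≈_
    ; _∙_ = _+_
    ; ε = []
    ; _⁻¹ = -_
    ; isAbelianGroup = record
      { isGroup = record
        { isMonoid = record
          { isSemigroup = record
            { isMagma = record
              { isEquivalence = record { refl = refl ; sym = sym ; trans = trans }
              ; ∙-cong = +-cong
              }
            ; assoc = +-assoc
            }
          ; identity = (λ _ → refl) , +-identityʳ
          }
        ; inverse = -‿inverseˡ , λ p → trans (+-comm p (- p)) (-‿inverseˡ p)
        ; ⁻¹-cong = -‿cong
        }
      ; comm = +-comm
      }
    }

  private
    module + = Algebra.Properties.CommutativeSemigroup
      (AbelianGroup.commutativeSemigroup +-abelianGroup)

  ·-cong : ∀ {a b p q} → a D.≈ b → p ≈ q → a · p ≈ b · q
  ·-cong {a} {b} {p} {q} e f = coeffwise λ i →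
    D.trans (coeff-· a p i) (D.trans (D.*-cong e (at f i)) (D.sym (coeff-· b q i)))

  ·-zeroˡ : ∀ {a} p → a D.≈ D.0# → a · p ≈ []
  ·-zeroˡ {a} p e = coeffwise λ i →
    D.trans (coeff-· a p i) (D.trans (D.*-congʳ e) (D.zeroˡ _))

  ·-distribʳ : ∀ a b p → (a D.+ b) · p ≈ a · p + b · p
  ·-distribʳ a b p = coeffwise λ i →
    D.trans (coeff-· (a D.+ b) p i) (D.trans (D.distribʳ _ a b) (D.sym
      (D.trans (coeff-+ (a · p) (b · p) i) (D.+-cong (coeff-· a p i) (coeff-· b p i)))))

  ·-distribˡ : ∀ a p q → a · (p + q) ≈ a · p + a · q
  ·-distribˡ a p q = coeffwise λ i →
    D.trans (coeff-· a (p + q) i) (D.trans (D.*-congˡ (coeff-+ p q i))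
      (D.trans (D.distribˡ a _ _) (D.sym
        (D.trans (coeff-+ (a · p) (a · q) i) (D.+-cong (coeff-· a p i) (coeff-· a q i))))))

  ·-assoc : ∀ a b p → (a D.* b) · p ≈ a · (b · p)
  ·-assoc a b p = coeffwise λ i →
    D.trans (coeff-· (a D.* b) p i) (D.trans (D.*-assoc a b _) (D.sym
      (D.trans (coeff-· a (b · p) i) (D.*-congˡ (coeff-· b p i)))))

  0∷-+ : ∀ p q → D.0# ∷ (p + q) ≈ (D.0# ∷ p) + (D.0# ∷ q)
  0∷-+ p q = ∷-cong (D.sym (D.+-identityˡ _)) refl

  *-congˡ : ∀ p {q r} → q ≈ r → p * q ≈ p * r
  *-congˡ []      e = refl
  *-congˡ (a ∷ p) e = +-cong (·-cong D.refl e) (∷-cong D.refl (*-congˡ p e))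

  *-zeroʳ : ∀ p → p * [] ≈ []
  *-zeroʳ []      = refl
  *-zeroʳ (a ∷ p) = ∷≈[] D.refl (*-zeroʳ p)

  *-∷ : ∀ p b q → p * (b ∷ q) ≈ b · p + (D.0# ∷ p * q)
  *-∷ []      b q = sym (∷≈[] D.refl refl)
  *-∷ (a ∷ p) b q = ∷-cong (D.+-congʳ (D.*-comm a b))
    (trans (+-cong refl (*-∷ p b q)) (+.x∙yz≈y∙xz (a · q) (b · p) (D.0# ∷ p * q)))

  *-comm : ∀ p q → p * q ≈ q * p
  *-comm []      q = sym (*-zeroʳ q)
  *-comm (a ∷ p) q =
    trans (+-cong (refl {a · q}) (∷-cong D.refl (*-comm p q))) (sym (*-∷ q a p))

  *-cong : ∀ {p p′ q q′} → p ≈ p′ → q ≈ q′ → p * q ≈ p′ * q′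
  *-cong {p} {p′} {q} {q′} e f = trans (*-congˡ p f)
    (trans (*-comm p q′) (trans (*-congˡ q′ e) (*-comm q′ p′)))

  *-distribʳ : ∀ r p q → (p + q) * r ≈ p * r + q * r
  *-distribʳ r []      q       = refl
  *-distribʳ r (a ∷ p) []      = sym (+-identityʳ ((a ∷ p) * r))
  *-distribʳ r (a ∷ p) (b ∷ q) =
    trans (+-cong (·-distribʳ a b r)
            (trans (∷-cong D.refl (*-distribʳ r p q)) (0∷-+ (p * r) (q * r))))
          (+.interchange (a · r) (b · r) (D.0# ∷ p * r) (D.0# ∷ q * r))

  *-distribˡ : ∀ r p q → r * (p + q) ≈ r * p + r * q
  *-distribˡ r p q = trans (*-comm r (p + q))
    (trans (*-distribʳ r p q) (+-cong (*-comm p r) (*-comm q r)))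

  ·-*-assoc : ∀ a p q → (a · p) * q ≈ a · (p * q)
  ·-*-assoc a []      q = refl
  ·-*-assoc a (b ∷ p) q =
    trans (+-cong (·-assoc a b q) (∷-cong (D.sym (D.zeroʳ a)) (·-*-assoc a p q)))
          (sym (·-distribˡ a (b · q) (D.0# ∷ p * q)))

  0∷-* : ∀ p q → (D.0# ∷ p) * q ≈ D.0# ∷ p * q
  0∷-* p q = +-cong (·-zeroˡ q D.refl) refl

  *-assoc : ∀ p q r → (p * q) * r ≈ p * (q * r)
  *-assoc []      q r = refl
  *-assoc (a ∷ p) q r =
    trans (*-distribʳ r (a · q) (D.0# ∷ p * q))
      (+-cong (·-*-assoc a q r)
              (trans (0∷-* (p * q) r) (∷-cong D.refl (*-assoc p q r))))

  *-identityˡ : ∀ p → 1# * p ≈ p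
  *-identityˡ p = trans (+-cong (coeffwise one) (∷≈[] D.refl refl)) (+-identityʳ p)
    where
    one : ∀ i → coeff (D.1# · p) i D.≈ coeff p i
    one i = D.trans (coeff-· D.1# p i) (D.*-identityˡ _)

  _≟_ : Binary.Decidable _≈_
  []      ≟ []      = yes refl
  []      ≟ (b ∷ q) = map′ (λ (e , f) → sym (∷≈[] e (sym f)))
                           (λ e → at (sym e) 0 , sym (tail≈[] (sym e)))
                           ((b D.≟ D.0#) ×-dec ([] ≟ q))
  (a ∷ p) ≟ []      = map′ (λ (e , f) → ∷≈[] e f)
                           (λ e → at e 0 , tail≈[] e)
                           ((a D.≟ D.0#) ×-dec (p ≟ []))
  (a ∷ p) ≟ (b ∷ q) = map′ (λ (e , f) → ∷-cong e f)
                           (λ e → at e 0 , tail-≈ e)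
                           ((a D.≟ b) ×-dec (p ≟ q))

  noZeroDivisors : ∀ p q → p * q ≈ [] → p ≈ [] ⊎ q ≈ []
  noZeroDivisors []      q = λ _ → inj₁ refl
  noZeroDivisors (a ∷ p) q = go (a D.≟ D.0#) q
    where
    go : Dec (a D.≈ D.0#) → ∀ q → (a ∷ p) * q ≈ [] → a ∷ p ≈ [] ⊎ q ≈ []
    go (yes a≈0) q e = Sum.map₁ (∷≈[] a≈0) (noZeroDivisors p q (tail≈[]
      (trans (sym (+-cong (·-zeroˡ q a≈0) (refl {D.0# ∷ p * q}))) e)))
    go (no a≉0) []      e = inj₂ refl
    go (no a≉0) (b ∷ q) e with D.noZeroDivisors (D.trans (D.sym (D.+-identityʳ _)) (at e 0))
    ... | inj₁ a≈0 = ⊥-elim (a≉0 a≈0)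
    ... | inj₂ b≈0 = Sum.map₂ (∷≈[] b≈0) (go (no a≉0) q (tail≈[]
      (trans (sym (trans (*-∷ (a ∷ p) b q)
        (+-cong (·-zeroˡ (a ∷ p) b≈0) (refl {D.0# ∷ (a ∷ p) * q})))) e)))

  domain : IntegralDomain
  domain = record
    { commutativeRing = record
      { Carrier = Poly
      ; _≈_ = _≈_
      ; _+_ = _+_
      ; _*_ = _*_
      ; -_ = -_
      ; 0# = 0#
      ; 1# = 1#
      ; isCommutativeRing = record
        { isRing = record
          { +-isAbelianGroup = AbelianGroup.isAbelianGroup +-abelianGroup
          ; *-cong = *-cong
          ; *-assoc = *-assoc
          ; *-identity = *-identityˡ , λ p → trans (*-comm p 1#) (*-identityˡ p)
          ; distrib = *-distribˡ , *-distribʳ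
          }
        ; *-comm = *-comm
        }
      }
    ; _≟_ = _≟_
    ; 1≉0 = λ e → D.1≉0 (at e 0)
    ; noZeroDivisors = λ {p} {q} → noZeroDivisors p q
    }

module Fractions (D : IntegralDomain) where
  private
    module D = IntegralDomain D
    module DG = Algebra.Properties.Group D.+-group

    open Algebra.Solver.Ring.NaturalCoefficients.Default D.commutativeSemiring
      using (solve; _:+_; _:*_; _:=_)

  record Fraction : Set where
    constructor _/_[_]
    field
      num   : D.Carrier
      den   : D.Carrier
      den≉0 : ¬ (den D.≈ D.0#)
  open Fraction public

  infix 4 _≈_
  record _≈_ (x y : Fraction) : Set where
    constructor cross
    field uncross : num x D.* den y D.≈ num y D.* den x
  open _≈_ public

  *-≉0 : ∀ {a b} → ¬ (a D.≈ D.0#) → ¬ (b D.≈ D.0#) → ¬ (a D.* b D.≈ D.0#)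
  *-≉0 a≉0 b≉0 e = Sum.[ a≉0 , b≉0 ] (D.noZeroDivisors e)

  infixl 6 _+_
  infixl 7 _*_
  infix  8 -_

  _+_ _*_ : Fraction → Fraction → Fraction
  (a / b [ p ]) + (c / d [ q ]) = (a D.* d D.+ c D.* b) / (b D.* d) [ *-≉0 p q ]
  (a / b [ p ]) * (c / d [ q ]) = (a D.* c) / (b D.* d) [ *-≉0 p q ]

  -_ : Fraction → Fraction
  - (a / b [ p ]) = (D.- a) / b [ p ]

  fromD : D.Carrier → Fraction
  fromD a = a / D.1# [ D.1≉0 ]

  0# 1# : Fraction
  0# = fromD D.0#
  1# = fromD D.1#

  open Algebra.Properties.Ring D.ring using (-‿distribˡ-*)
  open Relation.Binary.Reasoning.Setoid D.setoid

  cancelʳ : ∀ {a b d} → ¬ (d D.≈ D.0#) → a D.* d D.≈ b D.* d → a D.≈ b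
  cancelʳ {a} {b} {d} d≉0 e with D.noZeroDivisors {a D.+ D.- b} {d} (begin
      (a D.+ D.- b) D.* d           ≈⟨ D.distribʳ d a (D.- b) ⟩
      a D.* d D.+ (D.- b) D.* d     ≈⟨ D.+-cong e (D.sym (-‿distribˡ-* b d)) ⟩
      b D.* d D.+ D.- (b D.* d)     ≈⟨ D.-‿inverseʳ _ ⟩
      D.0#                          ∎)
  ... | inj₁ a-b≈0 = DG.x∙y⁻¹≈ε⇒x≈y a b a-b≈0
  ... | inj₂ d≈0   = ⊥-elim (d≉0 d≈0)

  refl : ∀ {x} → x ≈ x
  refl = cross D.refl

  sym : ∀ {x y} → x ≈ y → y ≈ x
  sym (cross e) = cross (D.sym e)

  swapʳ : ∀ a b c → (a D.* b) D.* c D.≈ (a D.* c) D.* b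
  swapʳ = solve 3
    (λ a b c →
      ((a :* b) :* c) :=
      ((a :* c) :* b))
    D.refl

  trans : ∀ {x y z} → x ≈ y → y ≈ z → x ≈ z
  trans {a / b [ _ ]} {c / d [ d≉0 ]} {e / f [ _ ]} (cross p) (cross q) =
    cross (cancelʳ d≉0 (begin
      (a D.* f) D.* d ≈⟨ swapʳ a f d ⟩
      (a D.* d) D.* f ≈⟨ D.*-congʳ p ⟩
      (c D.* b) D.* f ≈⟨ swapʳ c b f ⟩
      (c D.* f) D.* b ≈⟨ D.*-congʳ q ⟩
      (e D.* d) D.* b ≈⟨ swapʳ e d b ⟩
      (e D.* b) D.* d ∎))

  +-cong-lemma₁ : ∀ a b c d b′ d′ → (a D.* d D.+ c D.* b) D.* (b′ D.* d′)
    D.≈ (a D.* b′) D.* (d D.* d′) D.+ (c D.* d′) D.* (b D.* b′)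
  +-cong-lemma₁ = solve 6
    (λ a b c d b′ d′ →
      ((a :* d :+ c :* b) :* (b′ :* d′)) :=
      ((a :* b′) :* (d :* d′) :+ (c :* d′) :* (b :* b′)))
    D.refl

  +-cong-lemma₂ : ∀ a′ b′ c′ d′ b d → (a′ D.* b) D.* (d D.* d′) D.+ (c′ D.* d) D.* (b D.* b′)
    D.≈ (a′ D.* d′ D.+ c′ D.* b′) D.* (b D.* d)
  +-cong-lemma₂ = solve 6
    (λ a′ b′ c′ d′ b d →
      ((a′ :* b) :* (d :* d′) :+ (c′ :* d) :* (b :* b′)) :=
      ((a′ :* d′ :+ c′ :* b′) :* (b :* d)))
    D.refl

  +-cong : ∀ {x x′ y y′} → x ≈ x′ → y ≈ y′ → x + y ≈ x′ + y′
  +-cong {a / b [ _ ]} {a′ / b′ [ _ ]} {c / d [ _ ]} {c′ / d′ [ _ ]} (cross p) (cross q) =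
    cross (begin
      (a D.* d D.+ c D.* b) D.* (b′ D.* d′)                         ≈⟨ +-cong-lemma₁ a b c d b′ d′ ⟩
      (a D.* b′) D.* (d D.* d′) D.+ (c D.* d′) D.* (b D.* b′)       ≈⟨ D.+-cong (D.*-congʳ p) (D.*-congʳ q) ⟩
      (a′ D.* b) D.* (d D.* d′) D.+ (c′ D.* d) D.* (b D.* b′)       ≈⟨ +-cong-lemma₂ a′ b′ c′ d′ b d ⟩
      (a′ D.* d′ D.+ c′ D.* b′) D.* (b D.* d)                       ∎)

  interchange : ∀ a b c d → (a D.* b) D.* (c D.* d) D.≈ (a D.* c) D.* (b D.* d)
  interchange = solve 4
    (λ a b c d →
      ((a :* b) :* (c :* d)) :=
      ((a :* c) :* (b :* d)))
    D.refl

  *-cong : ∀ {x x′ y y′} → x ≈ x′ → y ≈ y′ → x * y ≈ x′ * y′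
  *-cong {a / b [ _ ]} {a′ / b′ [ _ ]} {c / d [ _ ]} {c′ / d′ [ _ ]} (cross p) (cross q) =
    cross (begin
      (a D.* c) D.* (b′ D.* d′)   ≈⟨ interchange a c b′ d′ ⟩
      (a D.* b′) D.* (c D.* d′)   ≈⟨ D.*-cong p q ⟩
      (a′ D.* b) D.* (c′ D.* d)   ≈⟨ interchange a′ b c′ d ⟩
      (a′ D.* c′) D.* (b D.* d)   ∎)

  -‿cong : ∀ {x y} → x ≈ y → - x ≈ - y
  -‿cong {a / b [ _ ]} {c / d [ _ ]} (cross p) = cross (begin
    (D.- a) D.* d   ≈⟨ -‿distribˡ-* a d ⟨
    D.- (a D.* d)   ≈⟨ D.-‿cong p ⟩
    D.- (c D.* b)   ≈⟨ -‿distribˡ-* c b ⟩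
    (D.- c) D.* b   ∎)

  +-assoc-lemma : ∀ a b c d e f →
    ((a D.* d D.+ c D.* b) D.* f D.+ e D.* (b D.* d)) D.* (b D.* (d D.* f))
    D.≈ (a D.* (d D.* f) D.+ (c D.* f D.+ e D.* d) D.* b) D.* ((b D.* d) D.* f)
  +-assoc-lemma = solve 6
    (λ a b c d e f →
      (((a :* d :+ c :* b) :* f :+ e :* (b :* d)) :* (b :* (d :* f))) :=
      ((a :* (d :* f) :+ (c :* f :+ e :* d) :* b) :* ((b :* d) :* f)))
    D.refl

  +-assoc : ∀ x y z → (x + y) + z ≈ x + (y + z)
  +-assoc (a / b [ _ ]) (c / d [ _ ]) (e / f [ _ ]) = cross (+-assoc-lemma a b c d e f)

  +-comm-lemma : ∀ a b c d →
    (a D.* d D.+ c D.* b) D.* (d D.* b) D.≈ (c D.* b D.+ a D.* d) D.* (b D.* d)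
  +-comm-lemma = solve 4
    (λ a b c d →
      ((a :* d :+ c :* b) :* (d :* b)) :=
      ((c :* b :+ a :* d) :* (b :* d)))
    D.refl

  +-comm : ∀ x y → x + y ≈ y + x
  +-comm (a / b [ _ ]) (c / d [ _ ]) = cross (+-comm-lemma a b c d)

  +-identityˡ : ∀ x → 0# + x ≈ x
  +-identityˡ (a / b [ _ ]) = cross (begin
    (D.0# D.* b D.+ a D.* D.1#) D.* b  ≈⟨ D.*-congʳ (D.+-cong (D.zeroˡ b) (D.*-identityʳ a)) ⟩
    (D.0# D.+ a) D.* b                 ≈⟨ D.*-cong (D.+-identityˡ a) (D.sym (D.*-identityˡ b)) ⟩
    a D.* (D.1# D.* b)                 ∎)

  -‿inverseˡ : ∀ x → - x + x ≈ 0#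
  -‿inverseˡ (a / b [ _ ]) = cross (begin
    ((D.- a) D.* b D.+ a D.* b) D.* D.1#  ≈⟨ D.*-identityʳ _ ⟩
    (D.- a) D.* b D.+ a D.* b             ≈⟨ D.distribʳ b (D.- a) a ⟨
    ((D.- a) D.+ a) D.* b                 ≈⟨ D.*-congʳ (D.-‿inverseˡ a) ⟩
    D.0# D.* b                            ≈⟨ D.zeroˡ b ⟩
    D.0#                                  ≈⟨ D.zeroˡ _ ⟨
    D.0# D.* (b D.* b)                    ∎)

  *-assoc-lemma : ∀ a b c d e f →
    ((a D.* c) D.* e) D.* (b D.* (d D.* f)) D.≈ (a D.* (c D.* e)) D.* ((b D.* d) D.* f)
  *-assoc-lemma = solve 6
    (λ a b c d e f →
      (((a :* c) :* e) :* (b :* (d :* f))) :=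
      ((a :* (c :* e)) :* ((b :* d) :* f)))
    D.refl

  *-assoc : ∀ x y z → (x * y) * z ≈ x * (y * z)
  *-assoc (a / b [ _ ]) (c / d [ _ ]) (e / f [ _ ]) = cross (*-assoc-lemma a b c d e f)

  *-comm-lemma : ∀ a b c d → (a D.* c) D.* (d D.* b) D.≈ (c D.* a) D.* (b D.* d)
  *-comm-lemma = solve 4
    (λ a b c d →
      ((a :* c) :* (d :* b)) :=
      ((c :* a) :* (b :* d)))
    D.refl

  *-comm : ∀ x y → x * y ≈ y * x
  *-comm (a / b [ _ ]) (c / d [ _ ]) = cross (*-comm-lemma a b c d)

  *-identityˡ : ∀ x → 1# * x ≈ x
  *-identityˡ (a / b [ _ ]) =
    cross (D.*-cong (D.*-identityˡ a) (D.sym (D.*-identityˡ b)))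

  distribˡ-lemma : ∀ a b c d e f →
    (a D.* (c D.* f D.+ e D.* d)) D.* ((b D.* d) D.* (b D.* f))
    D.≈ ((a D.* c) D.* (b D.* f) D.+ (a D.* e) D.* (b D.* d)) D.* (b D.* (d D.* f))
  distribˡ-lemma = solve 6
    (λ a b c d e f →
      ((a :* (c :* f :+ e :* d)) :* ((b :* d) :* (b :* f))) :=
      (((a :* c) :* (b :* f) :+ (a :* e) :* (b :* d)) :* (b :* (d :* f))))
    D.refl

  distribˡ : ∀ x y z → x * (y + z) ≈ x * y + x * z
  distribˡ (a / b [ _ ]) (c / d [ _ ]) (e / f [ _ ]) = cross (distribˡ-lemma a b c d e f)

  commutativeRing : CommutativeRing 0ℓ 0ℓ
  commutativeRing = record
    { Carrier = Fraction
    ; _≈_ = _≈_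
    ; _+_ = _+_
    ; _*_ = _*_
    ; -_ = -_
    ; 0# = 0#
    ; 1# = 1#
    ; isCommutativeRing = record
      { isRing = record
        { +-isAbelianGroup = record
          { isGroup = record
            { isMonoid = record
              { isSemigroup = record
                { isMagma = record
                  { isEquivalence = record { refl = refl ; sym = sym ; trans = trans }
                  ; ∙-cong = +-cong
                  }
                ; assoc = +-assoc
                }
              ; identity = +-identityˡ , λ x → trans (+-comm x 0#) (+-identityˡ x)
              }
            ; inverse = -‿inverseˡ , λ x → trans (+-comm x (- x)) (-‿inverseˡ x)
            ; ⁻¹-cong = -‿cong
            }
          ; comm = +-comm
          }
        ; *-cong = *-cong
        ; *-assoc = *-assoc
        ; *-identity = *-identityˡ , λ x → trans (*-comm x 1#) (*-identityˡ x)
        ; distrib = distribˡ , λ x y z → trans (*-comm (y + z) x)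
                      (trans (distribˡ x y z) (+-cong (*-comm x y) (*-comm x z)))
        }
      ; *-comm = *-comm
      }
    }

  private
    module F where
      open CommutativeRing commutativeRing public
      open Algebra.Properties.Group +-group public

  _≟_ : Binary.Decidable _≈_
  x ≟ y = map′ cross uncross (num x D.* den y D.≟ num y D.* den x)

  decSetoid : DecSetoid 0ℓ 0ℓ
  decSetoid = record
    { isDecEquivalence = record { isEquivalence = F.isEquivalence ; _≟_ = _≟_ } }

  num≈0⇒≈0 : ∀ x → num x D.≈ D.0# → x ≈ 0#
  num≈0⇒≈0 (a / b [ _ ]) e =
    cross (D.trans (D.*-congʳ e) (D.trans (D.zeroˡ _) (D.sym (D.zeroˡ _))))

  1≉0 : ¬ (1# ≈ 0#)
  1≉0 (cross e) = D.1≉0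
    (D.trans (D.sym (D.*-identityʳ _)) (D.trans e (D.*-identityʳ _)))

  inverse : ∀ x → ¬ (x ≈ 0#) → ∃[ x⁻¹ ] x⁻¹ * x ≈ 1#
  inverse (a / b [ b≉0 ]) x≉0 =
    b / a [ (λ a≈0 → x≉0 (num≈0⇒≈0 (a / b [ b≉0 ]) a≈0)) ] ,
    cross (D.trans (D.*-identityʳ _) (D.trans (D.*-comm b a) (D.sym (D.*-identityˡ _))))

  fractionField : HeytingField 0ℓ 0ℓ 0ℓ
  fractionField = record
    { Carrier = Fraction
    ; _≈_ = _≈_
    ; _#_ = λ x y → ¬ (x ≈ y)
    ; _+_ = _+_
    ; _*_ = _*_
    ; -_ = -_
    ; 0# = 0#
    ; 1# = 1#
    ; isHeytingField = record
      { isHeytingCommutativeRing = record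
        { isCommutativeRing = F.isCommutativeRing
        ; isApartnessRelation = ≉.≉-isApartnessRelation
        ; #⇒invertible = λ {x} {y} x≉y →
            let x⁻¹ , e = inverse (x F.- y) (λ z → x≉y (F.x∙y⁻¹≈ε⇒x≈y x y z))
            in  x⁻¹ , e , trans (*-comm (x F.- y) x⁻¹) e
        ; invertible⇒# = λ {x} {y} (z , e , _) x≈y → 1≉0 (trans (sym e)
            (trans (*-cong {z} {z} refl (F.x≈y⇒x∙y⁻¹≈ε x≈y)) (F.zeroʳ z)))
        }
      ; tight = ≉.≉-tight
      }
    }
    where module ≉ = Relation.Binary.Properties.DecSetoid decSetoid

ℚ-domain : IntegralDomain
ℚ-domain = record
  { commutativeRing = ℚ.+-*-commutativeRing
  ; _≟_ = ℚ._≟_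
  ; 1≉0 = λ ()
  ; noZeroDivisors = λ {p} {q} → noZeroDivisors p q
  }
  where
  open ≡.≡-Reasoning
  noZeroDivisors : ∀ p q → p ℚ.* q ≡ ℚ.0ℚ → p ≡ ℚ.0ℚ ⊎ q ≡ ℚ.0ℚ
  noZeroDivisors p q e with p ℚ.≟ ℚ.0ℚ
  ... | yes p≡0 = inj₁ p≡0
  ... | no  p≢0 = inj₂ (begin
    q                       ≡⟨ ℚ.*-identityˡ q ⟨
    ℚ.1ℚ ℚ.* q              ≡⟨ ≡.cong (ℚ._* q) (ℚ.*-inverseˡ p) ⟨
    (ℚ.1/ p ℚ.* p) ℚ.* q    ≡⟨ ℚ.*-assoc (ℚ.1/ p) p q ⟩
    ℚ.1/ p ℚ.* (p ℚ.* q)    ≡⟨ ≡.cong (ℚ.1/ p ℚ.*_) e ⟩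
    ℚ.1/ p ℚ.* ℚ.0ℚ         ≡⟨ ℚ.*-zeroʳ (ℚ.1/ p) ⟩
    ℚ.0ℚ                    ∎)
    where instance _ = ℚ.≢-nonZero p≢0

-- ℚ[t₀,…,tₘ] is the ring of polynomials in t₀ over ℚ[t₁,…,tₘ].
ℚ[_] : ℕ → IntegralDomain
ℚ[ zero  ] = ℚ-domain
ℚ[ suc m ] = Polynomials.domain ℚ[ m ]

indeterminate : ∀ {m} → Fin m → IntegralDomain.Carrier ℚ[ m ]
indeterminate {suc m} zero    = Polynomials.t ℚ[ m ]
indeterminate {suc m} (suc i) = Polynomials.const ℚ[ m ] (indeterminate i)

-- The rational function field ℚ(t₀,…,tₘ₋₁).
ℚ⟨_⟩ : ℕ → HeytingField 0ℓ 0ℓ 0ℓ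
ℚ⟨ m ⟩ = Fractions.fractionField ℚ[ m ]

infix 4 _of-size_
record KSubset (n k : ℕ) : Set where
  constructor _of-size_
  field
    set   : Subset n
    .size : ∣ set ∣ ≡ k
open KSubset public using (set)

-- In increasing order.
elements : ∀ {n} (S : Subset n) → Vec (Fin n) ∣ S ∣
elements []            = []
elements (inside  ∷ S) = zero ∷ Vec.map suc (elements S)
elements (outside ∷ S) = Vec.map suc (elements S)

element : ∀ {n k} → KSubset n k → Fin k → Fin n
element (S of-size size) i = Vec.lookup (elements S) (Fin.cast (≡.sym size) i)

include : ∀ {n k} → KSubset n k → KSubset (suc n) (suc k)
include (S of-size size) = inside ∷ S of-size ≡.cong suc size

exclude : ∀ {n k} → KSubset n k → KSubset (suc n) k
exclude (S of-size size) = outside ∷ S of-size size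

kSubsets : ∀ n k → List (KSubset n k)
kSubsets zero    zero    = ([] of-size ≡.refl) ∷ []
kSubsets zero    (suc k) = []
kSubsets (suc n) zero    = List.map exclude (kSubsets n zero)
kSubsets (suc n) (suc k) =
  List.map include (kSubsets n k) ++ List.map exclude (kSubsets n (suc k))

∈-kSubsets : ∀ {n k} (S : KSubset n k) → S ∈ kSubsets n k
∈-kSubsets {zero}  {zero}  ([] of-size _)             = here ≡.refl
∈-kSubsets {suc n} {zero}  (outside ∷ S of-size size) = ∈-map⁺ exclude (∈-kSubsets (S of-size size))
∈-kSubsets {suc n} {suc k} (inside  ∷ S of-size size) =
  ∈-++⁺ˡ (∈-map⁺ include (∈-kSubsets (S of-size ℕ.suc-injective size)))
∈-kSubsets {suc n} {suc k} (outside ∷ S of-size size) =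
  ∈-++⁺ʳ (List.map include (kSubsets n k)) (∈-map⁺ exclude (∈-kSubsets (S of-size size)))

include-injective : ∀ {n k} {S T : KSubset n k} → include S ≡ include T → S ≡ T
include-injective ≡.refl = ≡.refl

exclude-injective : ∀ {n k} {S T : KSubset n k} → exclude S ≡ exclude T → S ≡ T
exclude-injective ≡.refl = ≡.refl

kSubsets-unique : ∀ n k → Unique (kSubsets n k)
kSubsets-unique zero    zero    = [] ∷ []
kSubsets-unique zero    (suc k) = []
kSubsets-unique (suc n) zero    = map⁺ exclude-injective (kSubsets-unique n zero)
kSubsets-unique (suc n) (suc k) =
  ++⁺ (map⁺ include-injective (kSubsets-unique n k))
      (map⁺ exclude-injective (kSubsets-unique n (suc k)))
      λ (x , y) → disjoint (∈-map⁻ include x) (∈-map⁻ exclude y)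
  where
  disjoint : {S : KSubset (suc n) (suc k)} →
    ∃ (λ T → T ∈ kSubsets n k × S ≡ include T) →
    ¬ ∃ (λ T → T ∈ kSubsets n (suc k) × S ≡ exclude T)
  disjoint (_ , _ , ≡.refl) (_ , _ , ())

record Family (n k : ℕ) : Set₁ where
  field
    Member  : Pred (KSubset n k) 0ℓ
    member? : Decidable Member

  members : List (KSubset n k)
  members = List.filter member? (kSubsets n k)

  card : ℕ
  card = List.length members
open Family public using (Member; members; card)

Matrix : ∀ {a b c} → Set a → Set b → Set c → Set (a ⊔ b ⊔ c)
Matrix A I J = I → J → A

module Determinants {c ℓ} (R : CommutativeRing c ℓ) where
  open CommutativeRing R hiding (zero)
  open Algebra.Properties.Semiring.Sum semiring using (sum)
  open Algebra.Properties.Semiring.Exp semiring using (_^_)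

  -- Laplace expansion along the first row.
  det : ∀ {k} → Matrix Carrier (Fin k) (Fin k) → Carrier
  det {zero}  A = 1#
  det {suc k} A = sum λ j →
    (- 1#) ^ Fin.toℕ j * (A zero j * det λ r c → A (suc r) (Fin.punchIn j c))

  compound : ∀ {n} k → Matrix Carrier (Fin n) (Fin n) →
             Matrix Carrier (KSubset n k) (KSubset n k)
  compound k A S T = det λ i j → A (element S i) (element T j)

module Rank {c ℓ₁ ℓ₂} (K : HeytingField c ℓ₁ ℓ₂) where
  open HeytingField K
  open CommutativeRing
    (HeytingCommutativeRing.commutativeRing heytingCommutativeRing)
    using (semiring)
  open Algebra.Properties.Semiring.Sum semiring using (sum)

  LinearlyIndependentRows : ∀ {r j} {J : Set j} → Matrix Carrier (Fin r) J → Set (c ⊔ ℓ₁ ⊔ j)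
  LinearlyIndependentRows {r} A = ∀ (w : Fin r → Carrier) →
    (∀ j → sum (λ i → w i * A i j) ≈ 0#) → ∀ i → w i ≈ 0#

  -- r is the largest number of linearly independent rows. Selected rows
  -- need not be assumed distinct: a repetition is a dependency.
  HasRank : ∀ {i j} {I : Set i} {J : Set j} → Matrix Carrier I J → ℕ → Set (c ⊔ ℓ₁ ⊔ i ⊔ j)
  HasRank {I = I} A r =
    (∃ λ (ρ : Fin r → I) → LinearlyIndependentRows (A ∘ ρ)) ×
    (∀ {s} (ρ : Fin s → I) → LinearlyIndependentRows (A ∘ ρ) → s ℕ.≤ r)

module _ (n : ℕ) where
  private
    module K = HeytingField ℚ⟨ n ℕ.* n ⟩

  genericMatrix : Matrix K.Carrier (Fin n) (Fin n)
  genericMatrix i j =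
    Fractions.fromD ℚ[ n ℕ.* n ] (indeterminate (Fin.combine i j))

  genericCompound : ∀ k → Matrix K.Carrier (KSubset n k) (KSubset n k)
  genericCompound k = Determinants.compound
    (HeytingCommutativeRing.commutativeRing K.heytingCommutativeRing) k genericMatrix

submatrix : ∀ {n k} (F₂ F₁ : Family n k) →
            Matrix (HeytingField.Carrier ℚ⟨ n ℕ.* n ⟩) (Fin (card F₂)) (Fin (card F₁))
submatrix {n} {k} F₂ F₁ i j =
  genericCompound n k (List.lookup (members F₂) i) (List.lookup (members F₁) j)

_Dominates_ : ∀ {n k} → Family n k → Family n k → Set
_Dominates_ {n} F₁ F₂ = Rank.HasRank ℚ⟨ n ℕ.* n ⟩ (submatrix F₂ F₁) (card F₂)

-- A graph on [n] is its edge set.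
Graph : ℕ → Set₁
Graph n = Family n 2

-- The vertex i : Fin n stands for label i ∈ {1,…,n}.
label : ∀ {n} → Fin n → ℕ
label i = suc (Fin.toℕ i)

-- A 2-subset e is {a,b} with a = element e 0 < b = element e 1.
B : ∀ n → Graph n
B n = record
  { Member  = λ e → label (element e zero) ℕ.+ label (element e (suc zero)) ℕ.≤ n
  ; member? = λ e → label (element e zero) ℕ.+ label (element e (suc zero)) ℕ.≤? n
  }

{-# OPTIONS --safe #-}
-- If u and v are not adjacent in G, or if G is complete, then every other
-- vertex is adjacent to u or to v. Setting aside such a pair again and again
-- arranges the vertices as p₁, …, pₙ so that, writing j̄ = n + 1 - j, for
-- c < d < c̄ one of p_c and p_c̄ is adjacent to p_d. Specialize row i of X to
-- e_{p_i} + e_{p_ī} if i < ī and to e_{p_i} otherwise. For a row {c,d} of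
-- B(n), consider the column given by an edge from p_c or p_c̄ to p_d: the minor
-- in row {c,d} is ±1, and the only other row that can be nonzero there is
-- {c,d̄}, when d̄ < d. So the specialized rows are independent.
--
-- Independence lifts from the specialization to X one indeterminate at a time:
-- if the rows become independent at t = c, then every polynomial relation
-- between them is divisible by t - c, and dividing lowers its degree, so the
-- relation is zero.
module Submission where

open import Defs
open import Algebra.Bundles using (CommutativeRing)
open import Algebra.Morphism.Structures using (module RingMorphisms)
open import Data.Bool.Base using (Bool; true; false; if_then_else_)
open import Data.Fin.Base as Fin using (Fin; zero; suc; _<_; opposite; inject₁; fromℕ; punchIn; toℕ)
import Data.Fin.Properties as Fin
open import Data.Fin.Relation.Unary.Top using (view; ‵fromℕ; ‵inject₁; view-fromℕ; view-inject₁)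
open import Data.Fin.Subset using (Subset; inside; outside; ∣_∣; _∈_; _∉_; _⊆_; _∪_; ⁅_⁆)
import Data.Fin.Subset.Properties as Subset
open import Data.List.Base as List using (List; []; _∷_)
import Data.List.Membership.Propositional as List
import Data.List.Membership.Propositional.Properties as List
import Data.List.Relation.Unary.All as All
open import Data.List.Relation.Unary.Any as Any using (Any)
import Data.List.Relation.Unary.Any.Properties as Any
open import Data.List.Relation.Unary.Unique.Propositional using (Unique; _∷_)
import Data.List.Relation.Unary.Unique.Propositional.Properties as Unique
open import Data.Nat.Base as ℕ using (ℕ; zero; suc; z≤n; s≤s)
import Data.Nat.Properties as ℕ
open import Data.Product.Base using (∃; ∃₂; _×_; _,_; proj₁; proj₂; uncurry)
open import Data.Rational.Base using (ℚ)
open import Data.Sum.Base as Sum using (_⊎_; inj₁; inj₂; [_,_]′)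
open import Data.Vec.Base as Vec using (_∷_; here; there)
import Data.Vec.Properties as Vec
open import Function.Base using (_∘_; id)
open import Level using (0ℓ; _⊔_)
open import Relation.Binary.Core using (Rel)
open import Relation.Binary.Definitions using (Decidable)
open import Relation.Binary.PropositionalEquality as ≡ using (_≡_; _≢_)
open import Relation.Nullary using (¬_; Dec; yes; no; does; contradiction)
open import Relation.Nullary.Decidable using (¬?; _×-dec_; _⊎-dec_; decidable-stable; dec-true; dec-false)
import Algebra.Morphism.Construct.Composition
import Algebra.Morphism.Construct.Identity
import Algebra.Properties.CommutativeSemigroup
import Algebra.Properties.Ring
import Algebra.Properties.Semiring.Exp
import Algebra.Properties.Semiring.Sum
import Relation.Binary.Reasoning.Setoid

-- Linear independence of rows

module Independence {c ℓ} (R : CommutativeRing c ℓ) where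
  open CommutativeRing R hiding (zero)
  open Algebra.Properties.Semiring.Sum semiring
  open Algebra.Properties.Ring ring using (-‿distribʳ-*; -0#≈0#; -‿involutive)
  open Relation.Binary.Reasoning.Setoid setoid

  Independent : ∀ {r} {J : Set} → Matrix Carrier (Fin r) J → Set (c ⊔ ℓ)
  Independent {r} A = ∀ (w : Fin r → Carrier) →
    (∀ j → sum (λ i → w i * A i j) ≈ 0#) → ∀ i → w i ≈ 0#

  independent-cong : ∀ {r} {J : Set} {A B : Matrix Carrier (Fin r) J} →
    (∀ i j → A i j ≈ B i j) → Independent A → Independent B
  independent-cong A≈B indep w wB≈0 = indep w λ j →
    trans (sum-cong-≋ λ i → *-congˡ (A≈B i j)) (wB≈0 j)

  sum-zero : ∀ {r} {f : Fin r → Carrier} → (∀ i → f i ≈ 0#) → sum f ≈ 0#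
  sum-zero {r} f≈0 = trans (sum-cong-≋ f≈0) (sum-replicate-zero r)

  sum-single : ∀ {r} {f : Fin r → Carrier} i →
    (∀ i′ → i′ ≢ i → f i′ ≈ 0#) → sum f ≈ f i
  sum-single {suc r} {f} i f≈0 = begin
    sum f                                ≈⟨ sum-remove {i = i} f ⟩
    f i + sum (λ k → f (Fin.punchIn i k)) ≈⟨ +-congˡ (sum-zero λ k → f≈0 _ (Fin.punchInᵢ≢i i k)) ⟩
    f i + 0#                             ≈⟨ +-identityʳ _ ⟩
    f i                                  ∎

  *-cancel-unit : ∀ {x u} → u ≈ 1# ⊎ u ≈ - 1# → x * u ≈ 0# → x ≈ 0#
  *-cancel-unit {x} {u} (inj₁ u≈1) xu≈0 =
    trans (sym (*-identityʳ x)) (trans (*-congˡ (sym u≈1)) xu≈0)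
  *-cancel-unit {x} {u} (inj₂ u≈-1) xu≈0 = begin
    x           ≈⟨ -‿involutive x ⟨
    - - x       ≈⟨ -‿cong (begin
      - x         ≈⟨ -‿cong (*-identityʳ x) ⟨
      - (x * 1#)  ≈⟨ -‿distribʳ-* x 1# ⟩
      x * - 1#    ≈⟨ *-congˡ u≈-1 ⟨
      x * u       ≈⟨ xu≈0 ⟩
      0#          ∎) ⟩
    - 0#        ≈⟨ -0#≈0# ⟩
    0#          ∎

  -- In the column of a row in `L` the pivot is the only possible nonzero entry, so the coefficients
  -- of these rows vanish first. The column of any other row can meet, besides its pivot, only rows
  -- in `L`, which are already settled.
  two-step-triangular : ∀ {r} {J : Set} (A : Matrix Carrier (Fin r) J) (L : Fin r → Set)
    (col : Fin r → J) →
    (∀ i → A i (col i) ≈ 1# ⊎ A i (col i) ≈ - 1#) →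
    (∀ i i′ → i′ ≢ i → A i′ (col i) ≈ 0# ⊎ (L i′ × ¬ L i)) →
    Independent A
  two-step-triangular A L col unit off w wA≈0 i = solve i λ i′ (l , _) → solve i′ λ _ (_ , ¬l) →
    contradiction l ¬l
    where
    solve : ∀ i → (∀ i′ → L i′ × ¬ L i → w i′ ≈ 0#) → w i ≈ 0#
    solve i known = *-cancel-unit (unit i)
      (trans (sym (sum-single i λ i′ i′≢i → [ (λ e → trans (*-congˡ e) (zeroʳ _))
                                             , (λ l → trans (*-congʳ (known i′ l)) (zeroˡ _)) ]′
                                             (off i i′ i′≢i)))
             (wA≈0 (col i)))

  -- By pigeonhole a longer selection repeats a row, and the difference of two equal rows is a
  -- nontrivial relation. This gives the upper bound in `HasRank`.
  independent⇒≤ : ¬ (1# ≈ 0#) → ∀ {r s} {J : Set} (A : Matrix Carrier (Fin r) J)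
    (ρ : Fin s → Fin r) → Independent (A ∘ ρ) → s ℕ.≤ r
  independent⇒≤ 1≉0 {r} {s} A ρ indep with s ℕ.≤? r
  ... | yes s≤r = s≤r
  ... | no  s≰r
    with k , l , k<l , ρk≡ρl ← Fin.pigeonhole (ℕ.≰⇒> s≰r) ρ =
    contradiction (trans (sym w[k]≈1) (indep w wA≈0 k)) 1≉0
    where
    δ : Fin s → Fin s → Carrier
    δ i i′ with i Fin.≟ i′
    ... | yes _ = 1#
    ... | no  _ = 0#

    δ-diag : ∀ i → δ i i ≈ 1#
    δ-diag i with i Fin.≟ i
    ... | yes _ = refl
    ... | no i≢i = contradiction ≡.refl i≢i

    δ-off : ∀ {i i′} → i′ ≢ i → δ i i′ ≈ 0#
    δ-off {i} {i′} i′≢i with i Fin.≟ i′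
    ... | yes i≡i′ = contradiction (≡.sym i≡i′) i′≢i
    ... | no  _    = refl

    sum-δ : ∀ i f → sum (λ i′ → δ i i′ * f i′) ≈ f i
    sum-δ i f = trans (sum-single i λ i′ i′≢i → trans (*-congʳ (δ-off i′≢i)) (zeroˡ _))
                      (trans (*-congʳ (δ-diag i)) (*-identityˡ _))

    w : Fin s → Carrier
    w i = δ k i + - 1# * δ l i

    w[k]≈1 : w k ≈ 1#
    w[k]≈1 = trans (+-cong (δ-diag k) (trans (*-congˡ (δ-off (Fin.<⇒≢ k<l))) (zeroʳ _)))
                   (+-identityʳ 1#)

    wA≈0 : ∀ j → sum (λ i → w i * A (ρ i) j) ≈ 0#
    wA≈0 j = begin
      sum (λ i → w i * f i)                                       ≈⟨ sum-cong-≋ expand ⟩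
      sum (λ i → δ k i * f i + - 1# * (δ l i * f i))               ≈⟨ ∑-distrib-+ _ (λ i → - 1# * (δ l i * f i)) ⟩
      sum (λ i → δ k i * f i) + sum (λ i → - 1# * (δ l i * f i))   ≈⟨ +-cong (sum-δ k f) sum-−δ ⟩
      f k + - 1# * f l                                            ≡⟨ ≡.cong (λ x → f k + - 1# * A x j) (≡.sym ρk≡ρl) ⟩
      f k + - 1# * f k                                            ≈⟨ +-congʳ (*-identityˡ _) ⟨
      1# * f k + - 1# * f k                                       ≈⟨ distribʳ _ _ _ ⟨
      (1# + - 1#) * f k                                           ≈⟨ *-congʳ (-‿inverseʳ 1#) ⟩
      0# * f k                                                    ≈⟨ zeroˡ _ ⟩
      0#                                                          ∎
      where
      f : Fin s → Carrier
      f i = A (ρ i) j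

      expand : ∀ i → w i * f i ≈ δ k i * f i + - 1# * (δ l i * f i)
      expand i = trans (distribʳ (f i) (δ k i) _) (+-congˡ (*-assoc (- 1#) (δ l i) (f i)))

      sum-−δ : sum (λ i → - 1# * (δ l i * f i)) ≈ - 1# * f l
      sum-−δ = trans (sym (*-distribˡ-sum (- 1#) λ i → δ l i * f i)) (*-congˡ (sum-δ l f))

  *-combination : ∀ {r} x (w f : Fin r → Carrier) →
    x * sum (λ i → w i * f i) ≈ sum (λ i → (x * w i) * f i)
  *-combination x w f = trans (*-distribˡ-sum x λ i → w i * f i)
    (sum-cong-≋ λ i → sym (*-assoc x (w i) (f i)))

  -- For `b` = t and `a` = c the hypothesis is w = (t - c) q, stated without subtraction; the
  -- conclusion has the shape that `cancelʳ` takes.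
  combination-quotient : ∀ {r} a b (w q f : Fin r → Carrier) →
    (∀ i → w i + a * q i ≈ b * q i) → sum (λ i → w i * f i) ≈ 0# →
    b * sum (λ i → q i * f i) ≈ a * sum (λ i → q i * f i)
  combination-quotient a b w q f w+aq≈bq wf≈0 = begin
    b * sum (λ i → q i * f i)                             ≈⟨ *-combination b q f ⟩
    sum (λ i → (b * q i) * f i)                           ≈⟨ sum-cong-≋ (λ i → trans (*-congʳ (sym (w+aq≈bq i))) (distribʳ _ _ _)) ⟩
    sum (λ i → w i * f i + (a * q i) * f i)               ≈⟨ ∑-distrib-+ _ (λ i → (a * q i) * f i) ⟩
    sum (λ i → w i * f i) + sum (λ i → (a * q i) * f i)   ≈⟨ +-cong wf≈0 (sym (*-combination a q f)) ⟩
    0# + a * sum (λ i → q i * f i)                        ≈⟨ +-identityˡ _ ⟩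
    a * sum (λ i → q i * f i)                             ∎

  quotient≈0 : ∀ {a b w q} → w + a * q ≈ b * q → q ≈ 0# → w ≈ 0#
  quotient≈0 {a} {b} {w} {q} w+aq≈bq q≈0 = begin
    w          ≈⟨ +-identityʳ w ⟨
    w + 0#     ≈⟨ +-congˡ (trans (*-congˡ q≈0) (zeroʳ a)) ⟨
    w + a * q  ≈⟨ w+aq≈bq ⟩
    b * q      ≈⟨ *-congˡ q≈0 ⟩
    b * 0#     ≈⟨ zeroʳ b ⟩
    0#         ∎

-- 2 by 2 determinants

module DeterminantProperties {c ℓ} (R : CommutativeRing c ℓ) where
  open CommutativeRing R hiding (zero)
  open Determinants R
  open Algebra.Properties.Semiring.Exp semiring using (_^_)
  open Algebra.Properties.Semiring.Sum semiring using (sum-cong-≋)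
  open Algebra.Properties.Ring ring using (-‿distribˡ-*; -0#≈0#)
  open Relation.Binary.Reasoning.Setoid setoid

  det-cong : ∀ {k} {A B : Matrix Carrier (Fin k) (Fin k)} →
    (∀ i j → A i j ≈ B i j) → det A ≈ det B
  det-cong {zero}  A≈B = refl
  det-cong {suc k} A≈B = sum-cong-≋ λ j → *-congˡ {(- 1#) ^ Fin.toℕ j}
    (*-cong (A≈B zero j) (det-cong λ r c → A≈B (suc r) (Fin.punchIn j c)))

  private
    0F 1F : Fin 2
    0F = zero
    1F = suc zero

  det₂ : ∀ A → det A ≈ A 0F 0F * A 1F 1F + - (A 0F 1F * A 1F 0F)
  det₂ A = +-cong
    (trans (*-identityˡ _) (*-congˡ (det₁ (A 1F 1F))))
    (begin
      (- 1# * 1#) * (A 0F 1F * _) + 0#  ≈⟨ +-identityʳ _ ⟩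
      (- 1# * 1#) * (A 0F 1F * _)       ≈⟨ *-cong (*-identityʳ _) (*-congˡ (det₁ (A 1F 0F))) ⟩
      - 1# * (A 0F 1F * A 1F 0F)        ≈⟨ -‿distribˡ-* _ _ ⟨
      - (1# * (A 0F 1F * A 1F 0F))      ≈⟨ -‿cong (*-identityˡ _) ⟩
      - (A 0F 1F * A 1F 0F)             ∎)
    where
    -- This is the unsimplified Laplace expansion of a 1 by 1 cofactor.
    det₁ : ∀ a → 1# * (a * 1#) + 0# ≈ a
    det₁ a = trans (+-identityʳ _) (trans (*-identityˡ _) (*-identityʳ a))

  private
    *≈0 : ∀ {x y} → x ≈ 0# ⊎ y ≈ 0# → x * y ≈ 0#
    *≈0 (inj₁ x≈0) = trans (*-congʳ x≈0) (zeroˡ _)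
    *≈0 (inj₂ y≈0) = trans (*-congˡ y≈0) (zeroʳ _)

    *≈1 : ∀ {x y} → x ≈ 1# → y ≈ 1# → x * y ≈ 1#
    *≈1 x≈1 y≈1 = trans (*-cong x≈1 y≈1) (*-identityˡ 1#)

  det₂≈0 : ∀ A → A 0F 0F ≈ 0# ⊎ A 1F 1F ≈ 0# → A 0F 1F ≈ 0# ⊎ A 1F 0F ≈ 0# → det A ≈ 0#
  det₂≈0 A p q = trans (det₂ A)
    (trans (+-cong (*≈0 p) (trans (-‿cong (*≈0 q)) -0#≈0#)) (+-identityʳ 0#))

  det₂≈1 : ∀ A → A 0F 0F ≈ 1# → A 1F 1F ≈ 1# → A 0F 1F ≈ 0# ⊎ A 1F 0F ≈ 0# → det A ≈ 1#
  det₂≈1 A p p′ q = trans (det₂ A)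
    (trans (+-cong (*≈1 p p′) (trans (-‿cong (*≈0 q)) -0#≈0#)) (+-identityʳ 1#))

  det₂≈-1 : ∀ A → A 0F 1F ≈ 1# → A 1F 0F ≈ 1# → A 0F 0F ≈ 0# ⊎ A 1F 1F ≈ 0# → det A ≈ - 1#
  det₂≈-1 A p p′ q = trans (det₂ A)
    (trans (+-cong (*≈0 q) (-‿cong (*≈1 p p′))) (+-identityˡ (- 1#)))

-- Ring homomorphisms, sums and determinants

IsHomomorphism : ∀ {c ℓ c′ ℓ′} (R : CommutativeRing c ℓ) (S : CommutativeRing c′ ℓ′) →
  (CommutativeRing.Carrier R → CommutativeRing.Carrier S) → Set _
IsHomomorphism R S = RingMorphisms.IsRingHomomorphism
  (CommutativeRing.rawRing R) (CommutativeRing.rawRing S)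

bit : ∀ {c ℓ} (R : CommutativeRing c ℓ) → Bool → CommutativeRing.Carrier R
bit R b = if b then CommutativeRing.1# R else CommutativeRing.0# R

module Homomorphism {c ℓ c′ ℓ′} (R : CommutativeRing c ℓ) (S : CommutativeRing c′ ℓ′)
  {φ : CommutativeRing.Carrier R → CommutativeRing.Carrier S}
  (isHomomorphism : IsHomomorphism R S φ) where
  private
    module R = CommutativeRing R
    module S = CommutativeRing S
    module R∑ = Algebra.Properties.Semiring.Sum R.semiring
    module S∑ = Algebra.Properties.Semiring.Sum S.semiring
    module R^ = Algebra.Properties.Semiring.Exp R.semiring
    module S^ = Algebra.Properties.Semiring.Exp S.semiring
    module RD = Determinants R
    module SD = Determinants S

  open RingMorphisms.IsRingHomomorphism isHomomorphism public

  sum-homo : ∀ {r} (f : Fin r → R.Carrier) → φ (R∑.sum f) S.≈ S∑.sum (φ ∘ f)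
  sum-homo {zero}  f = 0#-homo
  sum-homo {suc r} f = S.trans (+-homo _ _) (S.+-congˡ (sum-homo (f ∘ suc)))

  ^-homo : ∀ x k → φ (x R^.^ k) S.≈ φ x S^.^ k
  ^-homo x zero    = 1#-homo
  ^-homo x (suc k) = S.trans (*-homo _ _) (S.*-congˡ (^-homo x k))

  det-homo : ∀ {k} (A : Matrix R.Carrier (Fin k) (Fin k)) →
    φ (RD.det A) S.≈ SD.det (λ i j → φ (A i j))
  det-homo {zero}  A = 1#-homo
  det-homo {suc k} A = S.trans (sum-homo λ j →
      (R.- R.1#) R^.^ Fin.toℕ j R.* (A zero j R.* RD.det λ r c → A (suc r) (Fin.punchIn j c)))
    (S∑.sum-cong-≋ λ j → S.trans (*-homo ((R.- R.1#) R^.^ Fin.toℕ j) _) (S.*-cong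
      (S.trans (^-homo _ (Fin.toℕ j)) (S^.^-congˡ (Fin.toℕ j)
        (S.trans (-‿homo _) (S.-‿cong 1#-homo))))
      (S.trans (*-homo (A zero j) _) (S.*-congˡ (det-homo λ r c → A (suc r) (Fin.punchIn j c))))))

  combination-homo : ∀ {r} (w f : Fin r → R.Carrier) →
    φ (R∑.sum λ i → w i R.* f i) S.≈ S∑.sum λ i → φ (w i) S.* φ (f i)
  combination-homo w f =
    S.trans (sum-homo λ i → w i R.* f i) (S∑.sum-cong-≋ λ i → *-homo (w i) (f i))

  bit-homo : ∀ b → φ (bit R b) S.≈ bit S b
  bit-homo true  = 1#-homo
  bit-homo false = 0#-homo

-- Lifting independence from an evaluation

ReflectsIndependence : ∀ {c ℓ c′ ℓ′} (R : CommutativeRing c ℓ) (S : CommutativeRing c′ ℓ′) →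
  (CommutativeRing.Carrier R → CommutativeRing.Carrier S) → Set _
ReflectsIndependence R S φ = ∀ {r} {J : Set} (A : Matrix _ (Fin r) J) →
  Independence.Independent S (λ i j → φ (A i j)) → Independence.Independent R A

bounded-above : ∀ {r} (f : Fin r → ℕ) → ∃ λ k → ∀ i → f i ℕ.≤ k
bounded-above {zero}  f = 0 , λ ()
bounded-above {suc r} f = let k , f≤k = bounded-above (f ∘ suc) in
  f zero ℕ.⊔ k , λ where
    zero    → ℕ.m≤m⊔n (f zero) k
    (suc i) → ℕ.m≤n⇒m≤o⊔n (f zero) (f≤k i)

module Evaluation (D : IntegralDomain) (c : IntegralDomain.Carrier D) where
  private
    module D = IntegralDomain D
    module P where
      open Polynomials D public
      open IntegralDomain domain public using (commutativeRing; semiring; +-congˡ)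
    module D∑ = Algebra.Properties.Semiring.Sum D.semiring
    module P∑ = Algebra.Properties.Semiring.Sum P.semiring
    module D+ = Algebra.Properties.CommutativeSemigroup D.+-commutativeSemigroup
    module D* = Algebra.Properties.CommutativeSemigroup D.*-commutativeSemigroup
    open P using (Poly)

  eval : Poly → D.Carrier
  eval []      = D.0#
  eval (a ∷ p) = a D.+ c D.* eval p

  -- A list equal to zero need not be empty, because trailing zeros are allowed; `eval-cong` uses
  -- this to compare lists of different lengths.
  eval-zero : ∀ p → p P.≈ [] → eval p D.≈ D.0#
  eval-zero []      e = D.refl
  eval-zero (a ∷ p) e = D.trans
    (D.+-cong (P.at e 0) (D.trans (D.*-congˡ (eval-zero p (P.tail≈[] e))) (D.zeroʳ c)))
    (D.+-identityʳ D.0#)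

  eval-cong : ∀ {p q} → p P.≈ q → eval p D.≈ eval q
  eval-cong {[]}    {q}     e = D.sym (eval-zero q (P.sym e))
  eval-cong {a ∷ p} {[]}    e = eval-zero (a ∷ p) e
  eval-cong {a ∷ p} {b ∷ q} e =
    D.+-cong (P.at e 0) (D.*-congˡ (eval-cong (P.tail-≈ e)))

  eval-+ : ∀ p q → eval (p P.+ q) D.≈ eval p D.+ eval q
  eval-+ []      q       = D.sym (D.+-identityˡ _)
  eval-+ (a ∷ p) []      = D.sym (D.+-identityʳ _)
  eval-+ (a ∷ p) (b ∷ q) = D.trans
    (D.+-congˡ (D.trans (D.*-congˡ (eval-+ p q)) (D.distribˡ c _ _)))
    (D+.interchange a b _ _)

  eval-· : ∀ a p → eval (a P.· p) D.≈ a D.* eval p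
  eval-· a []      = D.sym (D.zeroʳ a)
  eval-· a (b ∷ p) = D.trans
    (D.+-congˡ (D.trans (D.*-congˡ (eval-· a p)) (D*.x∙yz≈y∙xz c a _)))
    (D.sym (D.distribˡ a b _))

  eval-* : ∀ p q → eval (p P.* q) D.≈ eval p D.* eval q
  eval-* []      q = D.sym (D.zeroˡ _)
  eval-* (a ∷ p) q = D.trans (eval-+ (a P.· q) (D.0# ∷ p P.* q)) (D.trans
    (D.+-cong (eval-· a q) (D.trans (D.+-identityˡ _)
      (D.trans (D.*-congˡ (eval-* p q)) (D.sym (D.*-assoc c _ _)))))
    (D.sym (D.distribʳ (eval q) a _)))

  eval-neg : ∀ p → eval (P.- p) D.≈ D.- eval p
  eval-neg []      = D.sym (-0#≈0#)
    where open Algebra.Properties.Ring D.ring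
  eval-neg (a ∷ p) = D.trans
    (D.+-congˡ (D.trans (D.*-congˡ (eval-neg p)) (D.sym (-‿distribʳ-* c _))))
    (D.sym (D.trans (D.-‿cong (D.+-comm a _)) (-‿anti-homo-+ _ a)))
    where open Algebra.Properties.Ring D.ring

  eval-const : ∀ a → eval (P.const a) D.≈ a
  eval-const a = D.trans (D.+-congˡ (D.zeroʳ c)) (D.+-identityʳ a)

  eval-t : eval P.t D.≈ c
  eval-t = D.trans (D.+-identityˡ _) (D.trans (D.*-congˡ (eval-const D.1#)) (D.*-identityʳ c))

  eval-isHomomorphism : IsHomomorphism P.commutativeRing D.commutativeRing eval
  eval-isHomomorphism = record
    { isSemiringHomomorphism = record
      { isNearSemiringHomomorphism = record
        { +-isMonoidHomomorphism = record
          { isMagmaHomomorphism = record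
            { isRelHomomorphism = record { cong = eval-cong }
            ; homo = eval-+
            }
          ; ε-homo = D.refl
          }
        ; *-homo = eval-*
        }
      ; 1#-homo = eval-const D.1#
      }
    ; -‿homo = eval-neg
    }

  -- The quotient of a ∷ p by t - c, which does not depend on a.
  quotient : Poly → Poly
  quotient []      = []
  quotient (b ∷ p) = eval (b ∷ p) ∷ quotient p

  length-quotient : ∀ p → List.length (quotient p) ≡ List.length p
  length-quotient []      = ≡.refl
  length-quotient (b ∷ p) = ≡.cong suc (length-quotient p)

  -- Division with remainder by t - c, with both sides moved so that no
  -- subtraction occurs: p + c q = t q + p(c).
  division : ∀ a p → (a ∷ p) P.+ c P.· quotient p P.≈ eval (a ∷ p) ∷ quotient p
  division a []      = P.∷-cong (D.sym (eval-const a)) P.refl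
  division a (b ∷ p) = P.∷-cong D.refl (division b p)

  divide : Poly → Poly
  divide []      = []
  divide (a ∷ p) = quotient p

  -- List length is the measure for the descent, in place of degree: division shortens every
  -- nonempty list by exactly one, whatever its trailing zeros.
  length-divide : ∀ p {k} → List.length p ℕ.≤ suc k → List.length (divide p) ℕ.≤ k
  length-divide []      _           = ℕ.z≤n
  length-divide (a ∷ p) (ℕ.s≤s p≤k) = ≡.subst (ℕ._≤ _) (≡.sym (length-quotient p)) p≤k

  -- In `division` the remainder is the constant coefficient on the right, so at a root the right
  -- side is t times the quotient. Scaling and shifting are then written as products, to fit
  -- `combination-quotient`.
  divide-root : ∀ p → eval p D.≈ D.0# → p P.+ P.const c P.* divide p P.≈ P.t P.* divide p
  divide-root p p[c]≈0 = P.trans (P.+-congˡ {p} (const-* c (divide p)))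
    (P.trans (root p p[c]≈0) (P.sym (t-* (divide p))))
    where
    const-* : ∀ a q → P.const a P.* q P.≈ a P.· q
    const-* a q = P.trans (P.+-congˡ {a P.· q} (P.∷≈[] D.refl P.refl)) (P.+-identityʳ (a P.· q))

    t-* : ∀ q → P.t P.* q P.≈ D.0# ∷ q
    t-* q = P.trans (P.0∷-* P.1# q) (P.∷-cong D.refl (P.*-identityˡ q))

    root : ∀ p → eval p D.≈ D.0# → p P.+ c P.· divide p P.≈ D.0# ∷ divide p
    root []      _ = P.sym (P.∷≈[] D.refl P.refl)
    root (a ∷ p) e = P.trans (division a p) (P.∷-cong e P.refl)

  t≉const : ¬ (P.t P.≈ P.const c)
  t≉const e = D.1≉0 (P.at e 1)

  -- Evaluating a relation w at `c` forces every w_i(c) = 0, so w = (t - c) q, and q is again a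
  -- relation, with shorter lists. Descent on a common bound of the lengths ends at empty lists.
  eval-reflects : ReflectsIndependence P.commutativeRing D.commutativeRing eval
  eval-reflects {r} {J} A indep w = let k , w≤k = bounded-above (List.length ∘ w) in bounded k w w≤k
    where
    open Homomorphism P.commutativeRing D.commutativeRing eval-isHomomorphism using (combination-homo)
    open Independence P.commutativeRing

    bounded : ∀ k (w : Fin r → Poly) → (∀ i → List.length (w i) ℕ.≤ k) →
      (∀ j → P∑.sum (λ i → w i P.* A i j) P.≈ []) → ∀ i → w i P.≈ []
    bounded zero    w w≤0 _    i with w i | w≤0 i
    ... | [] | _ = P.refl
    bounded (suc k) w w≤k wA≈0 i = quotient≈0 {P.const c} {P.t} (division-w i) (bounded k q q≤k qA≈0 i)
      where
      w[c]≈0 : ∀ i → eval (w i) D.≈ D.0#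
      w[c]≈0 = indep (eval ∘ w) λ j →
        D.trans (D.sym (combination-homo w (λ i → A i j))) (eval-cong (wA≈0 j))

      q : Fin r → Poly
      q = divide ∘ w

      q≤k : ∀ i → List.length (q i) ℕ.≤ k
      q≤k i = length-divide (w i) (w≤k i)

      division-w : ∀ i → w i P.+ P.const c P.* q i P.≈ P.t P.* q i
      division-w i = divide-root (w i) (w[c]≈0 i)

      qA≈0 : ∀ j → P∑.sum (λ i → q i P.* A i j) P.≈ []
      -- A nonzero sum could be cancelled from both sides, leaving t = c.
      qA≈0 j with P∑.sum (λ i → q i P.* A i j) P.≟ []
      ... | yes qA≈0 = qA≈0
      ... | no  qA≉0 = contradiction
        (Fractions.cancelʳ P.domain {P.t} {P.const c} qA≉0
          (combination-quotient (P.const c) P.t w q (λ i → A i j) division-w (wA≈0 j)))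
        t≉const

-- Independence over the field of fractions

module FractionIndependence (D : IntegralDomain) where
  private
    module D = IntegralDomain D
    module F where
      open Fractions D public
      open CommutativeRing commutativeRing public
        using (semiring; setoid; *-congˡ; *-congʳ; zeroʳ)
    module D∑ = Algebra.Properties.Semiring.Sum D.semiring
    module F∑ = Algebra.Properties.Semiring.Sum F.semiring
    open F using (Fraction; fromD; cross; uncross)

  fromD-cong : ∀ {a b} → a D.≈ b → fromD a F.≈ fromD b
  fromD-cong a≈b = cross (D.*-congʳ a≈b)

  fromD-isHomomorphism : IsHomomorphism D.commutativeRing F.commutativeRing fromD
  fromD-isHomomorphism = record
    { isSemiringHomomorphism = record
      { isNearSemiringHomomorphism = record
        { +-isMonoidHomomorphism = record
          { isMagmaHomomorphism = record
            { isRelHomomorphism = record { cong = fromD-cong }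
            ; homo = λ a b → cross (D.*-cong
                (D.+-cong (D.sym (D.*-identityʳ a)) (D.sym (D.*-identityʳ b)))
                (D.*-identityʳ D.1#))
            }
          ; ε-homo = F.refl
          }
        ; *-homo = λ a b → cross (D.*-congˡ (D.*-identityʳ D.1#))
        }
      ; 1#-homo = F.refl
      }
    ; -‿homo = λ a → F.refl
    }

  clear-denominator : ∀ x {a} → a D.≈ F.den x → fromD a F.* x F.≈ fromD (F.num x)
  clear-denominator x a≈den = cross (D.trans (D.*-identityʳ _)
    (D.trans (D.*-comm _ _) (D.*-congˡ (D.trans a≈den (D.sym (D.*-identityˡ _))))))

  -- The product of all denominators works: it is nonzero in a domain, and each numerator is
  -- multiplied by the other denominators.
  common-denominator : ∀ {r} (w : Fin r → Fraction) →
    ∃₂ λ d (v : Fin r → D.Carrier) → ¬ (d D.≈ D.0#) × (∀ i → fromD d F.* w i F.≈ fromD (v i))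
  common-denominator {zero}  w = D.1# , (λ ()) , D.1≉0 , λ ()
  common-denominator {suc r} w
    with d , v , d≉0 , dw≈v ← common-denominator (w ∘ suc) =
    b D.* d , v′ , F.*-≉0 (F.den≉0 (w zero)) d≉0 , eq
    where
    b = F.den (w zero)
    v′ : Fin (suc r) → D.Carrier
    v′ zero    = d D.* F.num (w zero)
    v′ (suc i) = b D.* v i

    open Homomorphism D.commutativeRing F.commutativeRing fromD-isHomomorphism using (*-homo)

    scale : ∀ a b′ {c} x y → c D.≈ a D.* b′ → fromD b′ F.* x F.≈ fromD y →
      fromD c F.* x F.≈ fromD (a D.* y)
    scale a b′ x y c≈ab e = F.trans (F.*-congʳ {x} (F.trans (fromD-cong c≈ab) (*-homo a b′)))
      (F.trans (F.*-assoc (fromD a) (fromD b′) x)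
        (F.trans (F.*-congˡ {fromD a} e) (F.sym (*-homo a y))))

    eq : ∀ i → fromD (b D.* d) F.* w i F.≈ fromD (v′ i)
    eq zero    = scale d b (w zero) _ (D.*-comm b d) (clear-denominator (w zero) D.refl)
    eq (suc i) = scale b d (w (suc i)) (v i) D.refl (dw≈v i)

  -- Multiplying a relation by a common denominator moves it into the domain, where its coefficients
  -- vanish.
  fromD-independent : ∀ {r} {J : Set} (A : Matrix D.Carrier (Fin r) J) →
    Independence.Independent D.commutativeRing A →
    Independence.Independent F.commutativeRing (λ i j → fromD (A i j))
  fromD-independent A indep w wA≈0 i
    with d , v , d≉0 , dw≈v ← common-denominator w =
    -- Cross-multiplied, d w_i = 0 says that d times the numerator of w_i is zero, and d is not.
    F.num≈0⇒≈0 (w i) ([ (λ d≈0 → contradiction d≈0 d≉0) , (λ e → e) ]′ (D.noZeroDivisors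
      (D.trans (D.sym (D.*-identityʳ _)) (D.trans
        (uncross (F.trans (dw≈v i) (fromD-cong (indep v vA≈0 i)))) (D.zeroˡ _)))))
    where
    open Homomorphism D.commutativeRing F.commutativeRing fromD-isHomomorphism using (combination-homo)
    open Independence F.commutativeRing using (*-combination)
    open Relation.Binary.Reasoning.Setoid F.setoid

    fromD-injective : ∀ {a b} → fromD a F.≈ fromD b → a D.≈ b
    fromD-injective {a} {b} (cross e) = D.trans (D.sym (D.*-identityʳ a)) (D.trans e (D.*-identityʳ b))

    vA≈0 : ∀ j → D∑.sum (λ i → v i D.* A i j) D.≈ D.0#
    vA≈0 j = fromD-injective (begin
      fromD (D∑.sum (λ i → v i D.* A i j))                    ≈⟨ combination-homo v (λ i → A i j) ⟩
      F∑.sum (λ i → fromD (v i) F.* fromD (A i j))            ≈⟨ F∑.sum-cong-≋ (λ i → F.*-congʳ {fromD (A i j)} (dw≈v i)) ⟨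
      F∑.sum (λ i → (fromD d F.* w i) F.* fromD (A i j))      ≈⟨ *-combination (fromD d) w (λ i → fromD (A i j)) ⟨
      fromD d F.* F∑.sum (λ i → w i F.* fromD (A i j))        ≈⟨ F.*-congˡ {fromD d} (wA≈0 j) ⟩
      fromD d F.* F.0#                                        ≈⟨ F.zeroʳ (fromD d) ⟩
      F.0#                                                    ∎)

-- Substituting 0 and 1 only, which ring homomorphisms preserve, needs no
-- embedding of ℚ into ℚ[ m ].
specialize : ∀ m → (Fin m → Bool) → IntegralDomain.Carrier ℚ[ m ] → ℚ
specialize zero    β p = p
specialize (suc m) β p = specialize m (β ∘ suc)
  (Evaluation.eval ℚ[ m ] (bit (IntegralDomain.commutativeRing ℚ[ m ]) (β zero)) p)

module Specialization where
  private
    ℚ-ring : CommutativeRing 0ℓ 0ℓ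
    ℚ-ring = IntegralDomain.commutativeRing ℚ-domain
    ring : ℕ → CommutativeRing 0ℓ 0ℓ
    ring m = IntegralDomain.commutativeRing ℚ[ m ]

  specialize-isHomomorphism : ∀ m (β : Fin m → Bool) →
    IsHomomorphism (ring m) ℚ-ring (specialize m β)
  specialize-isHomomorphism zero    β = isRingHomomorphism _ ≡.refl
    where open Algebra.Morphism.Construct.Identity
  specialize-isHomomorphism (suc m) β = isRingHomomorphism ≡.trans
    (Evaluation.eval-isHomomorphism ℚ[ m ] _) (specialize-isHomomorphism m (β ∘ suc))
    where open Algebra.Morphism.Construct.Composition

  specialize-reflects : ∀ m (β : Fin m → Bool) →
    ReflectsIndependence (ring m) ℚ-ring (specialize m β)
  specialize-reflects zero    β A indep = indep
  specialize-reflects (suc m) β A indep = Evaluation.eval-reflects ℚ[ m ] _ A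
    (specialize-reflects m (β ∘ suc) _ indep)

  -- The first indeterminate becomes a bit of the smaller ring, which the later evaluations
  -- preserve; the others are constants for the first evaluation.
  specialize-indeterminate : ∀ m (β : Fin m → Bool) i →
    specialize m β (indeterminate i) ≡ bit ℚ-ring (β i)
  specialize-indeterminate (suc m) β zero    =
    ≡.trans (⟦⟧-cong (Evaluation.eval-t ℚ[ m ] _)) (bit-homo (β zero))
    where open Homomorphism (ring m) ℚ-ring (specialize-isHomomorphism m (β ∘ suc))
  specialize-indeterminate (suc m) β (suc i) =
    ≡.trans (⟦⟧-cong (Evaluation.eval-const ℚ[ m ] _ (indeterminate i)))
            (specialize-indeterminate m (β ∘ suc) i)
    where open Homomorphism (ring m) ℚ-ring (specialize-isHomomorphism m (β ∘ suc))

open ≡ using (refl; cong; sym; trans; subst)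

-- Elements of k-subsets

lookup-shifted : ∀ {n} (S : Subset n) i →
  Vec.lookup (Vec.map Fin.suc (elements S)) i ≡ suc (Vec.lookup (elements S) i)
lookup-shifted S i = Vec.lookup-map i suc (elements S)

lookup-elements-< : ∀ {n} (S : Subset n) {i j} → i < j →
  Vec.lookup (elements S) i < Vec.lookup (elements S) j
lookup-elements-< (inside ∷ S) {zero} {suc j} _ =
  subst (λ x → 0 ℕ.< toℕ x) (sym (lookup-shifted S j)) (s≤s z≤n)
lookup-elements-< (inside ∷ S) {suc i} {suc j} (s≤s i<j) =
  ≡.subst₂ _<_ (sym (lookup-shifted S i)) (sym (lookup-shifted S j)) (s≤s (lookup-elements-< S i<j))
lookup-elements-< (outside ∷ S) {i} {j} i<j =
  ≡.subst₂ _<_ (sym (lookup-shifted S i)) (sym (lookup-shifted S j)) (s≤s (lookup-elements-< S i<j))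

lookup-elements-∈ : ∀ {n} (S : Subset n) i → Vec.lookup (elements S) i ∈ S
lookup-elements-∈ (inside  ∷ S) zero    = here
lookup-elements-∈ (inside  ∷ S) (suc i) =
  subst (_∈ _) (sym (lookup-shifted S i)) (there (lookup-elements-∈ S i))
lookup-elements-∈ (outside ∷ S) i       =
  subst (_∈ _) (sym (lookup-shifted S i)) (there (lookup-elements-∈ S i))

∈⇒lookup-elements : ∀ {n} (S : Subset n) {x} → x ∈ S → ∃ λ i → Vec.lookup (elements S) i ≡ x
∈⇒lookup-elements (inside ∷ S) here = zero , refl
∈⇒lookup-elements (inside ∷ S) (there x∈S) =
  let i , e = ∈⇒lookup-elements S x∈S in
  suc i , trans (lookup-shifted S i) (cong suc e)
∈⇒lookup-elements (outside ∷ S) (there x∈S) =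
  let i , e = ∈⇒lookup-elements S x∈S in
  i , trans (lookup-shifted S i) (cong suc e)

element-< : ∀ {n k} (S : KSubset n k) {i j} → i < j → element S i < element S j
element-< (S of-size size) {i} {j} i<j = lookup-elements-< S
  (≡.subst₂ ℕ._<_ (sym (Fin.toℕ-cast (sym size) i)) (sym (Fin.toℕ-cast (sym size) j)) i<j)

element-∈ : ∀ {n k} (S : KSubset n k) i → element S i ∈ set S
element-∈ (S of-size size) i = lookup-elements-∈ S (Fin.cast (sym size) i)

∈⇒element : ∀ {n k} (S : KSubset n k) {x} → x ∈ set S → ∃ λ i → element S i ≡ x
∈⇒element (S of-size size) x∈S =
  let i , e = ∈⇒lookup-elements S x∈S in
  Fin.cast size i ,
  trans (cong (Vec.lookup (elements S)) (Fin.cast-involutive (sym size) size i)) e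

-- A set consists of the values of its enumeration, so equal enumerations give both inclusions. This
-- identifies a row of B(n) by its two endpoints.
element-injective : ∀ {n k} {S T : KSubset n k} → (∀ i → element S i ≡ element T i) → S ≡ T
element-injective {S = S} {T} S≗T = set-injective (Subset.⊆-antisym (⊆ S T S≗T) (⊆ T S (sym ∘ S≗T)))
  where
  ⊆ : ∀ S T → (∀ i → element S i ≡ element T i) → set S ⊆ set T
  ⊆ S T S≗T x∈S = let i , e = ∈⇒element S x∈S in
    subst (_∈ set T) (trans (sym (S≗T i)) e) (element-∈ T i)

  set-injective : ∀ {n k} {S T : KSubset n k} → set S ≡ set T → S ≡ T
  -- The size proof is irrelevant, so only the sets are compared.
  set-injective refl = refl

-- Edges and triples

∣⁅x⁆∪p∣≡1+∣p∣ : ∀ {n} {x : Fin n} {p} → x ∉ p → ∣ ⁅ x ⁆ ∪ p ∣ ≡ suc ∣ p ∣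
∣⁅x⁆∪p∣≡1+∣p∣ {x = zero}  {inside  ∷ p} x∉p = contradiction here x∉p
∣⁅x⁆∪p∣≡1+∣p∣ {x = zero}  {outside ∷ p} x∉p = cong (suc ∘ ∣_∣) (Subset.∪-identityˡ p)
∣⁅x⁆∪p∣≡1+∣p∣ {x = suc x} {inside  ∷ p} x∉p = cong suc (∣⁅x⁆∪p∣≡1+∣p∣ (x∉p ∘ there))
∣⁅x⁆∪p∣≡1+∣p∣ {x = suc x} {outside ∷ p} x∉p = ∣⁅x⁆∪p∣≡1+∣p∣ (x∉p ∘ there)

triple : ∀ {n} {x y z : Fin n} → x ≢ y → x ≢ z → y ≢ z → KSubset n 3
triple {x = x} {y} {z} x≢y x≢z y≢z = (⁅ x ⁆ ∪ (⁅ y ⁆ ∪ ⁅ z ⁆)) of-size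
  trans (∣⁅x⁆∪p∣≡1+∣p∣ x∉yz)
    (cong suc (trans (∣⁅x⁆∪p∣≡1+∣p∣ (y≢z ∘ Subset.x∈⁅y⁆⇒x≡y z)) (cong suc (Subset.∣⁅x⁆∣≡1 z))))
  where
  x∉yz : x ∉ ⁅ y ⁆ ∪ ⁅ z ⁆
  x∉yz = [ x≢y ∘ Subset.x∈⁅y⁆⇒x≡y y , x≢z ∘ Subset.x∈⁅y⁆⇒x≡y z ]′ ∘ Subset.x∈p∪q⁻ _ _

∈-triple : ∀ {n} {x y z w : Fin n} (x≢y : x ≢ y) (x≢z : x ≢ z) (y≢z : y ≢ z) →
  w ∈ set (triple x≢y x≢z y≢z) → w ≡ x ⊎ w ≡ y ⊎ w ≡ z
∈-triple {x = x} {y} {z} _ _ _ =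
  Sum.map (Subset.x∈⁅y⁆⇒x≡y x) (Sum.map (Subset.x∈⁅y⁆⇒x≡y y) (Subset.x∈⁅y⁆⇒x≡y z) ∘ Subset.x∈p∪q⁻ _ _)
  ∘ Subset.x∈p∪q⁻ _ _

first second : ∀ {n} → KSubset n 2 → Fin n
first  e = element e zero
second e = element e (suc zero)

first<second : ∀ {n} (e : KSubset n 2) → first e < second e
first<second e = element-< e (s≤s z≤n)

-- Both orders occur, because `first` and `second` follow the numerical order of vertices while x
-- and y come from positions in the arrangement.
Joins : ∀ {n} → KSubset n 2 → Rel (Fin n) 0ℓ
Joins e x y = (first e ≡ x × second e ≡ y) ⊎ (first e ≡ y × second e ≡ x)

-- Stated on the list of members, so that a witness carries the index of a column of the submatrix.
Adjacent : ∀ {n} → Graph n → Rel (Fin n) 0ℓ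
Adjacent G x y = Any (λ e → Joins e x y) (members G)

adjacent? : ∀ {n} (G : Graph n) → Decidable (Adjacent G)
adjacent? G x y = Any.any?
  (λ e → (first e Fin.≟ x ×-dec second e Fin.≟ y) ⊎-dec (first e Fin.≟ y ×-dec second e Fin.≟ x))
  (members G)

HasEdgeInEveryTriple : ∀ {n} → Rel (Fin n) 0ℓ → Set
HasEdgeInEveryTriple _~_ = ∀ {x y z} → x ≢ y → x ≢ z → y ≢ z → x ~ y ⊎ x ~ z ⊎ y ~ z

-- The two endpoints of an edge inside the triple are among x, y, z and differ from each other,
-- which excludes the three diagonal cases.
adjacent-triple : ∀ {n} (G : Graph n) →
  (∀ (T : KSubset n 3) → ∃ λ (e : KSubset n 2) → Member G e × set e ⊆ set T) →
  HasEdgeInEveryTriple (Adjacent G)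
adjacent-triple G dense {x} {y} {z} x≢y x≢z y≢z
  with e , e∈G , e⊆T ← dense (triple x≢y x≢z y≢z) = joined
  (∈-triple x≢y x≢z y≢z (e⊆T (element-∈ e zero)))
  (∈-triple x≢y x≢z y≢z (e⊆T (element-∈ e (suc zero))))
  where
  edge : ∀ {x y} → Joins e x y → Adjacent G x y
  edge joins = List.lose (List.∈-filter⁺ (Family.member? G) (∈-kSubsets e) e∈G) joins

  loop : ∀ {x} → first e ≡ x → ¬ second e ≡ x
  loop p q = Fin.<⇒≢ (first<second e) (trans p (sym q))

  joined : first e ≡ x ⊎ first e ≡ y ⊎ first e ≡ z → second e ≡ x ⊎ second e ≡ y ⊎ second e ≡ z →
    Adjacent G x y ⊎ Adjacent G x z ⊎ Adjacent G y z
  joined (inj₁ p)        (inj₁ q)        = contradiction q (loop p)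
  joined (inj₁ p)        (inj₂ (inj₁ q)) = inj₁ (edge (inj₁ (p , q)))
  joined (inj₁ p)        (inj₂ (inj₂ q)) = inj₂ (inj₁ (edge (inj₁ (p , q))))
  joined (inj₂ (inj₁ p)) (inj₁ q)        = inj₁ (edge (inj₂ (p , q)))
  joined (inj₂ (inj₁ p)) (inj₂ (inj₁ q)) = contradiction q (loop p)
  joined (inj₂ (inj₁ p)) (inj₂ (inj₂ q)) = inj₂ (inj₂ (edge (inj₁ (p , q))))
  joined (inj₂ (inj₂ p)) (inj₁ q)        = inj₂ (inj₁ (edge (inj₂ (p , q))))
  joined (inj₂ (inj₂ p)) (inj₂ (inj₁ q)) = inj₂ (inj₂ (edge (inj₂ (p , q))))
  joined (inj₂ (inj₂ p)) (inj₂ (inj₂ q)) = contradiction q (loop p)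

-- Arrangements of the vertices

opposite-inject₁ : ∀ {n} (i : Fin n) → opposite (inject₁ i) ≡ suc (opposite i)
opposite-inject₁ zero    = refl
opposite-inject₁ (suc i) = cong inject₁ (opposite-inject₁ i)

opposite-< : ∀ {n} {i j : Fin n} → i < j → opposite j < opposite i
opposite-< {i = i} {j} i<j = ≡.subst₂ ℕ._<_ (sym (Fin.opposite-prop j)) (sym (Fin.opposite-prop i))
  (ℕ.∸-monoʳ-< (s≤s i<j) (Fin.toℕ<n j))

opposite-cancel-< : ∀ {n} {i j : Fin n} → opposite i < opposite j → j < i
opposite-cancel-< {i = i} {j} ī<j̄ =
  ≡.subst₂ _<_ (Fin.opposite-involutive j) (Fin.opposite-involutive i) (opposite-< ī<j̄)

-- `at` is the sequence p and `opposite` is the bar; in 0-based positions, c and c̄ add up to n - 1.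
record Arrangement {n} (_~_ : Rel (Fin n) 0ℓ) : Set where
  field
    at           : Fin n → Fin n
    at-injective : ∀ {i j} → at i ≡ at j → i ≡ j
    nested       : ∀ {i j} → i < j → j < opposite i → at i ~ at j ⊎ at (opposite i) ~ at j

covering-pair : ∀ {n} {_~_ : Rel (Fin (suc (suc n))) 0ℓ} → Decidable _~_ →
  HasEdgeInEveryTriple _~_ →
  ∃₂ λ u v → u ≢ v × (∀ {w} → u ≢ w → v ≢ w → u ~ w ⊎ v ~ w)
covering-pair _~?_ dense
  with Fin.any? (λ u → Fin.any? λ v → ¬? (u Fin.≟ v) ×-dec ¬? (u ~? v))
... | yes (u , v , u≢v , u≁v) = u , v , u≢v , λ u≢w v≢w →
  [ (λ u~v → contradiction u~v u≁v) , id ]′ (dense u≢v u≢w v≢w)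
-- The graph is complete here, so any pair works. The failed search gives only double negations,
-- which decidability removes.
... | no complete = zero , suc zero , (λ ()) , λ {w} 0≢w _ →
  inj₁ (decidable-stable (zero ~? w) λ 0≁w → complete (zero , w , 0≢w , 0≁w))

-- A covering pair takes the first and last positions and so encloses all others. The triple
-- condition passes to the remaining vertices, which are arranged in between by recursion.
arrange : ∀ n {_~_ : Rel (Fin n) 0ℓ} → Decidable _~_ →
  HasEdgeInEveryTriple _~_ → Arrangement _~_
arrange zero          _ _ = record { at = id ; at-injective = id ; nested = λ { {()} } }
arrange (suc zero)    _ _ = record { at = id ; at-injective = id ; nested = λ { {zero} {zero} () } }
arrange (suc (suc n)) {_~_} _~?_ dense
  with u , v , u≢v , covers ← covering-pair _~?_ dense = record
  { at = at ; at-injective = at-injective ; nested = nested }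
  where
  v′ : Fin (suc n)
  v′ = Fin.punchOut u≢v

  -- `ι` enumerates the vertices other than u and v; `v′` is the index of v once u is deleted.
  ι : Fin n → Fin (suc (suc n))
  ι i = punchIn u (punchIn v′ i)

  ι-injective : ∀ {i j} → ι i ≡ ι j → i ≡ j
  ι-injective = Fin.punchIn-injective v′ _ _ ∘ Fin.punchIn-injective u _ _

  u≢ι : ∀ {i} → u ≢ ι i
  u≢ι = Fin.punchInᵢ≢i u _ ∘ sym

  v≢ι : ∀ {i} → v ≢ ι i
  v≢ι v≡ι = Fin.punchInᵢ≢i v′ _
    (Fin.punchIn-injective u _ _ (sym (trans (Fin.punchIn-punchOut u≢v) v≡ι)))

  inner : Arrangement (λ i j → ι i ~ ι j)
  inner = arrange n (λ i j → ι i ~? ι j)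
    λ x≢y x≢z y≢z → dense (x≢y ∘ ι-injective) (x≢z ∘ ι-injective) (y≢z ∘ ι-injective)

  module Inner = Arrangement inner

  at : Fin (suc (suc n)) → Fin (suc (suc n))
  at zero = u
  at (suc i) with view i
  ... | ‵fromℕ     = v
  ... | ‵inject₁ i = ι (Inner.at i)

  at-last : at (suc (fromℕ n)) ≡ v
  at-last rewrite view-fromℕ n = refl

  at-middle : ∀ i → at (suc (inject₁ i)) ≡ ι (Inner.at i)
  at-middle i rewrite view-inject₁ i = refl

  at-injective : ∀ {i j} → at i ≡ at j → i ≡ j
  at-injective {zero} {zero} _ = refl
  at-injective {zero} {suc j} e with view j
  ... | ‵fromℕ     = contradiction e u≢v
  ... | ‵inject₁ j = contradiction e u≢ι
  at-injective {suc i} {zero} e with view i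
  ... | ‵fromℕ     = contradiction (sym e) u≢v
  ... | ‵inject₁ i = contradiction (sym e) u≢ι
  at-injective {suc i} {suc j} e with view i | view j
  ... | ‵fromℕ     | ‵fromℕ     = refl
  ... | ‵fromℕ     | ‵inject₁ j = contradiction e v≢ι
  ... | ‵inject₁ i | ‵fromℕ     = contradiction (sym e) v≢ι
  ... | ‵inject₁ i | ‵inject₁ j = cong (suc ∘ inject₁) (Inner.at-injective (ι-injective e))

  inject₁-reflects-< : ∀ {m} {i j : Fin m} → inject₁ i < inject₁ j → i < j
  inject₁-reflects-< {i = i} {j} = ≡.subst₂ ℕ._<_ (Fin.toℕ-inject₁ i) (Fin.toℕ-inject₁ j)

  nested : ∀ {i j} → i < j → j < opposite i → at i ~ at j ⊎ at (opposite i) ~ at j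
  nested {zero} {suc j} _ j<last with view j
  ... | ‵fromℕ     = contradiction j<last (Fin.<-irrefl {x = suc (fromℕ n)} refl)
  ... | ‵inject₁ j rewrite at-last = covers u≢ι v≢ι
  nested {suc i} {suc j} (s≤s i<j) j<ī with view i | view j
  ... | ‵fromℕ     | _          = contradiction (Fin.≤fromℕ j) (ℕ.<⇒≱ i<j)
  -- The last position is n + 1, while the mirror image of a position other than the first is at
  -- most n.
  ... | ‵inject₁ i | ‵fromℕ     = contradiction
    (Fin.≤fromℕ (opposite (inject₁ i))) (ℕ.<⇒≱ (ℕ.<-trans (ℕ.n<1+n _)
      (subst (suc (toℕ (fromℕ n)) ℕ.<_) (Fin.toℕ-inject₁ (opposite (inject₁ i))) j<ī)))
  -- The mirror image of `suc (inject₁ i)` is `suc (inject₁ (opposite i))`, so the outer reflection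
  -- restricts to the inner one.
  ... | ‵inject₁ i | ‵inject₁ j
    rewrite opposite-inject₁ i | at-middle (opposite i) =
    Inner.nested (inject₁-reflects-< i<j) (inject₁-reflects-< (ℕ.s<s⁻¹ j<ī))

-- The specialized matrix

module ArrangementMatrix {n} {_~_ : Rel (Fin n) 0ℓ} (arrangement : Arrangement _~_) where
  open Arrangement arrangement

  -- Rows are numbered by position and columns by vertex. Only rows i < ī get a second 1; this
  -- asymmetry makes the interaction of {c,d} and {c,d̄} one-sided.
  InSupport : Fin n → Fin n → Set
  InSupport i x = x ≡ at i ⊎ (i < opposite i × x ≡ at (opposite i))

  inSupport? : ∀ i x → Dec (InSupport i x)
  inSupport? i x = x Fin.≟ at i ⊎-dec (i Fin.<? opposite i ×-dec x Fin.≟ at (opposite i))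

  -- In 1-based labels, b < opposite a says that a + b ≤ n.
  Row : Fin n → Fin n → Set
  Row a b = a < b × b < opposite a

  row-outer : ∀ {a b} → Row a b → a < opposite a
  row-outer (a<b , b<ā) = ℕ.<-trans a<b b<ā

  End : Fin n → Fin n → Set
  End c z = z ≡ at c ⊎ z ≡ at (opposite c)

  swap-opposite : ∀ {a c : Fin n} → opposite a ≡ c → a ≡ opposite c
  swap-opposite {a} refl = sym (Fin.opposite-involutive a)

  end-positions : ∀ {b c z} → End c z → InSupport b z → b ≡ c ⊎ b ≡ opposite c
  end-positions         (inj₁ refl) (inj₁ e)       = inj₁ (sym (at-injective e))
  end-positions         (inj₁ refl) (inj₂ (_ , e)) = inj₂ (swap-opposite (sym (at-injective e)))
  end-positions         (inj₂ refl) (inj₁ e)       = inj₂ (sym (at-injective e))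
  end-positions {c = c} (inj₂ refl) (inj₂ (_ , e)) =
    inj₁ (trans (swap-opposite (sym (at-injective e))) (Fin.opposite-involutive c))

  -- The support forces a to be c or c̄; the latter is excluded because a < ā and c < c̄.
  end⇒outer-≡ : ∀ {a b c d z} → Row a b → Row c d → End c z → InSupport a z → a ≡ c
  end⇒outer-≡ {c = c} ab cd z∈c z∈a with end-positions z∈c z∈a
  ... | inj₁ a≡c  = a≡c
  ... | inj₂ refl = contradiction
    (subst (opposite c <_) (Fin.opposite-involutive c) (row-outer ab))
    (Fin.<-asym {x = c} (row-outer cd))

  inner-positions : ∀ {b d} → InSupport b (at d) → d ≡ b ⊎ (b < opposite b × d ≡ opposite b)
  inner-positions = Sum.map at-injective λ (b<b̄ , e) → b<b̄ , at-injective e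

  -- Otherwise a is d or d̄ and b is c or c̄, and each of the four combinations reverses one of the
  -- inequalities in a < b < ā and c < d < c̄. Hence the crossed term of the minor vanishes.
  no-crossing : ∀ {a b c d z} → Row a b → Row c d → End c z →
    InSupport a (at d) → ¬ InSupport b z
  no-crossing {a} {b} {c} {d} (a<b , b<ā) (c<d , d<c̄) z∈c d∈a z∈b =
    clash (Sum.map₂ proj₂ (inner-positions d∈a)) (end-positions z∈c z∈b)
    where
    clash : d ≡ a ⊎ d ≡ opposite a → ¬ (b ≡ c ⊎ b ≡ opposite c)
    clash (inj₁ refl) (inj₁ refl) = Fin.<-asym {x = a} a<b c<d
    clash (inj₁ refl) (inj₂ refl) = Fin.<-asym {x = c} c<d (opposite-cancel-< b<ā)
    clash (inj₂ refl) (inj₁ refl) = Fin.<-asym {x = a} a<b (opposite-cancel-< d<c̄)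
    clash (inj₂ refl) (inj₂ refl) = Fin.<-asym {x = opposite c} b<ā d<c̄

  module _ {c ℓ} (R : CommutativeRing c ℓ) where
    open CommutativeRing R hiding (zero; refl; sym; trans)
    open Independence R
    open DeterminantProperties R

    entry : Matrix Carrier (Fin n) (Fin n)
    entry i x = bit R (does (inSupport? i x))

    entry≈1 : ∀ {i x} → InSupport i x → entry i x ≈ 1#
    entry≈1 {i} {x} p = reflexive (cong (bit R) (dec-true (inSupport? i x) p))

    entry≈0 : ∀ {i x} → ¬ InSupport i x → entry i x ≈ 0#
    entry≈0 {i} {x} ¬p = reflexive (cong (bit R) (dec-false (inSupport? i x) ¬p))

    entries≈0 : ∀ {i x j y} → ¬ (InSupport i x × InSupport j y) → entry i x ≈ 0# ⊎ entry j y ≈ 0#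
    entries≈0 {i} {x} {j} {y} ¬p with inSupport? i x
    ... | yes p = inj₂ (entry≈0 λ q → ¬p (p , q))
    ... | no i∌x = inj₁ (entry≈0 i∌x)

    block : KSubset n 2 → KSubset n 2 → Matrix Carrier (Fin 2) (Fin 2)
    block e f i j = entry (element e i) (element f j)

    minor : KSubset n 2 → KSubset n 2 → Carrier
    minor = Determinants.compound R 2 entry

    -- If the edge lists its endpoints in the order y, z, the columns are swapped and the value is
    -- -1.
    unit-minor : ∀ e f {z y} → Joins f z y →
      InSupport (first e) z → InSupport (second e) y →
      ¬ (InSupport (first e) y × InSupport (second e) z) →
      minor e f ≈ 1# ⊎ minor e f ≈ - 1#
    unit-minor e f (inj₁ (refl , refl)) p q ¬r =
      inj₁ (det₂≈1 (block e f) (entry≈1 p) (entry≈1 q) (entries≈0 ¬r))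
    unit-minor e f (inj₂ (refl , refl)) p q ¬r =
      inj₂ (det₂≈-1 (block e f) (entry≈1 p) (entry≈1 q) (entries≈0 ¬r))

    zero-minor : ∀ e f {z y} → Joins f z y →
      ¬ (InSupport (first e) z × InSupport (second e) y) →
      ¬ (InSupport (first e) y × InSupport (second e) z) →
      minor e f ≈ 0#
    zero-minor e f (inj₁ (refl , refl)) ¬p ¬q = det₂≈0 (block e f) (entries≈0 ¬p) (entries≈0 ¬q)
    zero-minor e f (inj₂ (refl , refl)) ¬p ¬q = det₂≈0 (block e f) (entries≈0 ¬q) (entries≈0 ¬p)

    -- The pivot of row {c,d} is an edge from p_c or p_c̄ to p_d, and the rows with d < d̄ are
    -- solved first.
    minors-independent : ∀ {r s} (rows : Fin r → KSubset n 2) (cols : Fin s → KSubset n 2) →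
      (∀ {i j} → rows i ≡ rows j → i ≡ j) →
      (∀ i → Row (first (rows i)) (second (rows i))) →
      (∀ {x y} → x ~ y → ∃ λ j → Joins (cols j) x y) →
      Independent (λ i j → minor (rows i) (cols j))
    minors-independent {r} rows cols rows-injective isRow edge =
      two-step-triangular _ (FirstHalf ∘ second ∘ rows) (proj₁ ∘ column) unit off
      where
      FirstHalf : Fin n → Set
      FirstHalf b = b < opposite b

      column : ∀ i → ∃₂ λ j z → End (first (rows i)) z × Joins (cols j) z (at (second (rows i)))
      column i with uncurry nested (isRow i)
      ... | inj₁ c~d = let j , joins = edge c~d in j , _ , inj₁ refl , joins
      ... | inj₂ c̄~d = let j , joins = edge c̄~d in j , _ , inj₂ refl , joins

      unit : ∀ i → minor (rows i) (cols (proj₁ (column i))) ≈ 1#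
                 ⊎ minor (rows i) (cols (proj₁ (column i))) ≈ - 1#
      unit i with column i
      ... | j , z , z∈c , joins = unit-minor (rows i) (cols j) joins
        -- The end p_c̄ is in the support of row c because c < c̄.
        (Sum.map₂ (row-outer (isRow i) ,_) z∈c)
        (inj₁ refl)
        (uncurry (no-crossing (isRow i) (isRow i) z∈c))

      off : ∀ i i′ → i′ ≢ i → minor (rows i′) (cols (proj₁ (column i))) ≈ 0#
        ⊎ (FirstHalf (second (rows i′)) × ¬ FirstHalf (second (rows i)))
      off i i′ i′≢i with column i
      ... | j , z , z∈c , joins
        with inSupport? (first (rows i′)) z | inSupport? (second (rows i′)) (at (second (rows i)))
      ... | no z∉a | _      = inj₁ (zero-minor (rows i′) (cols j) joins (z∉a ∘ proj₁)
        (uncurry (no-crossing (isRow i′) (isRow i) z∈c)))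
      ... | yes _  | no d∉b = inj₁ (zero-minor (rows i′) (cols j) joins (d∉b ∘ proj₂)
        (uncurry (no-crossing (isRow i′) (isRow i) z∈c)))
      -- Here a = c, and b is d or d̄. If b = d the rows coincide; otherwise b < b̄ = d, so b lies
      -- in the first half and d does not.
      ... | yes z∈a | yes d∈b with inner-positions d∈b
      ...   | inj₁ d≡b = contradiction (rows-injective (element-injective λ
                { zero → end⇒outer-≡ (isRow i′) (isRow i) z∈c z∈a ; (suc zero) → sym d≡b })) i′≢i
      ...   | inj₂ (b<b̄ , d≡b̄) = inj₂ (b<b̄ , λ d<d̄ → Fin.<-asym {x = second (rows i′)} b<b̄
                (≡.subst₂ _<_ d≡b̄ (trans (cong opposite d≡b̄) (Fin.opposite-involutive _)) d<d̄))

-- From the specialized rows to the generic matrix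

lookup-injective : ∀ {A : Set} {xs : List A} → Unique xs → ∀ {i j} →
  List.lookup xs i ≡ List.lookup xs j → i ≡ j
lookup-injective (x∉xs ∷ u) {zero}  {zero}  e = refl
lookup-injective (x∉xs ∷ u) {zero}  {suc j} e = contradiction e (All.lookup x∉xs (List.∈-lookup j))
lookup-injective (x∉xs ∷ u) {suc i} {zero}  e = contradiction (sym e) (All.lookup x∉xs (List.∈-lookup i))
lookup-injective (x∉xs ∷ u) {suc i} {suc j} e = cong suc (lookup-injective u e)

-- Labels exceed positions by one and ā is n minus the label of a, so moving that label across the
-- inequality gives b < ā.
B⇒nested : ∀ {n} (e : KSubset n 2) → Member (B n) e → second e < opposite (first e)
B⇒nested {n} e a+b≤n = subst (Fin.toℕ (second e) ℕ.<_) (sym (Fin.opposite-prop (first e)))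
  (ℕ.m+n≤o⇒m≤o∸n (label (second e)) (subst (ℕ._≤ n) (ℕ.+-comm (label (first e)) _) a+b≤n))

adjacent⇒column : ∀ {n} (G : Graph n) {x y} → Adjacent G x y →
  ∃ λ j → Joins (List.lookup (members G) j) x y
adjacent⇒column G x~y = Any.index x~y , Any.lookup-index x~y

mainTheorem2 : ∀ (n : ℕ) (G : Graph n) →
    (∀ (T : KSubset n 3) → ∃ λ (e : KSubset n 2) → Member G e × set e ⊆ set T) →
    G Dominates (B n)
mainTheorem2 n G dense =
  -- Selecting every row reduces the rank claim to independence of all rows.
  (id , independent) ,
  λ ρ → independent⇒≤ (Fractions.1≉0 P) (submatrix (B n) G) ρ
  where
  P = ℚ[ n ℕ.* n ]
  module P = IntegralDomain P
  ℚ-ring = IntegralDomain.commutativeRing ℚ-domain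
  open Independence (Fractions.commutativeRing P)

  arrangement : Arrangement (Adjacent G)
  arrangement = arrange n (adjacent? G) (adjacent-triple G dense)

  open ArrangementMatrix arrangement

  rows : Fin (card (B n)) → KSubset n 2
  rows = List.lookup (members (B n))

  cols : Fin (card G) → KSubset n 2
  cols = List.lookup (members G)

  -- `Fin.remQuot` undoes the numbering by `Fin.combine`, so each indeterminate receives the 0/1
  -- entry at its own place.
  β : Fin (n ℕ.* n) → Bool
  β k = uncurry (λ i x → does (inSupport? i x)) (Fin.remQuot n k)

  φ : P.Carrier → _
  φ = specialize (n ℕ.* n) β

  X : Matrix P.Carrier (Fin n) (Fin n)
  X i x = indeterminate (Fin.combine i x)

  φX : ∀ i x → φ (X i x) ≡ entry ℚ-ring i x
  φX i x = trans (Specialization.specialize-indeterminate (n ℕ.* n) β (Fin.combine i x))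
    (cong (λ (i , x) → bit ℚ-ring (does (inSupport? i x))) (Fin.remQuot-combine i x))

  minors : Matrix P.Carrier (Fin (card (B n))) (Fin (card G))
  minors i j = Determinants.compound P.commutativeRing 2 X (rows i) (cols j)

  φ-minors : ∀ i j → φ (minors i j) ≡ minor ℚ-ring (rows i) (cols j)
  φ-minors i j = trans (det-homo λ k l → X (element (rows i) k) (element (cols j) l))
    (DeterminantProperties.det-cong ℚ-ring λ k l → φX (element (rows i) k) (element (cols j) l))
    where open Homomorphism P.commutativeRing ℚ-ring
            (Specialization.specialize-isHomomorphism (n ℕ.* n) β)

  -- Determinants commute with the embedding, so minors formed over polynomials agree with those
  -- formed in the field.
  fromD-minors : ∀ i j → Fractions._≈_ P (Fractions.fromD P (minors i j)) (submatrix (B n) G i j)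
  fromD-minors i j = det-homo λ k l → X (element (rows i) k) (element (cols j) l)
    where open Homomorphism P.commutativeRing (Fractions.commutativeRing P)
            (FractionIndependence.fromD-isHomomorphism P)

  isRow : ∀ i → Row (first (rows i)) (second (rows i))
  isRow i = first<second (rows i) , B⇒nested (rows i)
    (proj₂ (List.∈-filter⁻ (Family.member? (B n)) {xs = kSubsets n 2} (List.∈-lookup i)))

  independent : Independent (submatrix (B n) G)
  -- From the inside out: independence over ℚ, then over the polynomial ring, then over its field of
  -- fractions.
  independent = independent-cong fromD-minors
    (FractionIndependence.fromD-independent P minors
      (Specialization.specialize-reflects (n ℕ.* n) β minors
        (Independence.independent-cong ℚ-ring (λ i j → sym (φ-minors i j))
          (minors-independent ℚ-ring rows cols
            (lookup-injective (Unique.filter⁺ (Family.member? (B n)) (kSubsets-unique n 2)))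
            isRow (adjacent⇒column G)))))
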